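{- Let $U$ be a sunshine graph and $T$ a caterpillar, both of order $n$, with $b(U,T)\ge 5$. Let $U^+$ be a supercard of $U$ and $T$ that is a sunshine graph (with its chosen vertices $w,v$ and labelling as described in the context) which has the largest possible value of $\chi(U^+)$ over all supercards of $U$ and $T$ that are sunshine graphs. Then $b(U,T) \le 2\chi(U^+)+5$.
   Context: All graphs are finite and simple. For a graph $G$ and $v\in V(G)$, $G-v$ is obtained by deleting $v$ and its incident edges; the deck of $G$ is the multiset of unlabelled cards $G-v$; $b(G,H)$ is the cardinality of the multiset intersection of the decks of $G$ and $H$. A leaf is a vertex of degree 1; the skeleton of a graph is obtained by deleting all leaves and isolated vertices; a sunshine graph is a connected graph whose skeleton is a cycle; a caterpillar is a connected graph whose skeleton is a path. A supercard of $U$ and $T$ is a graph of order $n+1$ whose deck contains a card isomorphic to $U$ and a card isomorphic to $T$. For a sunshine supercard $U^+$, fix vertices $w,v$ with $U^+-w\cong U$ and $U^+-v\cong T$ (then $w$ is a leaf and $v$ is a degree-2 vertex of the cycle); identify $U$ with $U^+-w$ and $T$ with $U^+-v$. Label the cycle $x_0x_1\ldots x_{c-1}x_0$ (indices mod $c$) with $x_0$ the neighbour of $w$, $v=x_\nu$, and $d_{U^+}(x_{\nu-1})\ge d_{U^+}(x_{\nu+1})$. For a bijection $\lambda$ and graphs $G,H$ with $\lambda(V(G))=V(H)$, write $\lambda(G)=H$ if $\lambda$ is an isomorphism from $G$ to $H$. Let $B_{vw}(U^+)=\{\lambda\in \mathrm{Sym}(V(U^+)) : \lambda(U-\lambda^{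 -1}(v))=T-\lambda(w)\}$ and $B_U=\{\lambda\in B_{vw}(U^+): \lambda(U)=U^+-\lambda(w)\}$. A maximum saturating set is a set $X\subseteq B_{vw}(U^+)$ such that (1) the identity is in $X$; (2) any distinct $\lambda,\pi\in X$ satisfy $\lambda^{ -1}(v)\ne\pi^{ -1}(v)$ and $\lambda(w)\ne\pi(w)$; (3) there is no $\sigma\in B_{vw}(U^+)\setminus X$ such that $X\cup\{\sigma\}$ satisfies (2). Let $X_U=X\cap B_U$, and let $\chi(U^+)$ be the maximum of $|X_U|$ over all maximum saturating sets $X$. -}

module Defs where

open import Data.Nat using (ℕ; zero; suc; _+_; _≤_; _%_)
open import Data.Fin using (Fin; toℕ; punchIn; _≟_; fromℕ; inject₁)
open import Data.Fin.Properties using (all?)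
open import Data.Fin.Permutation using (Permutation′; _⟨$⟩ʳ_; _⟨$⟩ˡ_)
open import Data.Bool using (Bool; true; false; if_then_else_)
import Data.Bool.Properties as BoolP
open import Data.List using (List; length; filter; map; allFin)
open import Data.Nat.ListAction using (sum)
open import Data.Product using (Σ; ∃; _×_; _,_)
open import Data.Sum using (_⊎_)
open import Data.Empty using (⊥)
open import Function using (Injective)
open import Relation.Nullary using (¬_; Dec)
open import Relation.Nullary.Decidable using (¬?; _×-dec_; _→-dec_)
open import Relation.Binary.PropositionalEquality using (_≡_; _≢_)

record Graph (n : ℕ) : Set where
  field
    adj   : Fin n → Fin n → Bool
    sym   : ∀ x y → adj x y ≡ adj y x
    irref : ∀ x → adj x x ≡ false
open Graph public

del : ∀ {n} → Graph (suc n) → Fin (suc n) → Graph n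
adj   (del G v) i j = adj G (punchIn v i) (punchIn v j)
sym   (del G v) i j = sym G (punchIn v i) (punchIn v j)
irref (del G v) i   = irref G (punchIn v i)

_≅_ : ∀ {n} → Graph n → Graph n → Set
_≅_ {n} G H = Σ (Permutation′ n) λ σ →
  ∀ x y → adj G x y ≡ adj H (σ ⟨$⟩ʳ x) (σ ⟨$⟩ʳ y)

deg : ∀ {n} → Graph n → Fin n → ℕ
deg {n} G x = sum (map (λ y → if adj G x y then 1 else 0) (allFin n))

Walk : ∀ {n} → Graph n → Fin n → Fin n → ℕ → Set
Walk {n} G x y k = Σ (Fin (suc k) → Fin n) λ p →
  (p Fin.zero ≡ x) × (p (fromℕ k) ≡ y) ×
  (∀ (i : Fin k) → adj G (p (inject₁ i)) (p (Fin.suc i)) ≡ true)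

Connected : ∀ {n} → Graph n → Set
Connected G = ∀ x y → ∃ λ k → Walk G x y k

InSkel : ∀ {n} → Graph n → Fin n → Set
InSkel G x = 2 ≤ deg G x

EnumSkel : ∀ {n c} → Graph n → (Fin c → Fin n) → Set
EnumSkel G f = Injective _≡_ _≡_ f × (∀ i → InSkel G (f i)) ×
               (∀ x → InSkel G x → ∃ λ i → f i ≡ x)

CycAdj : (k : ℕ) → Fin (3 + k) → Fin (3 + k) → Set
CycAdj k i j = (toℕ j ≡ suc (toℕ i) % (3 + k)) ⊎ (toℕ i ≡ suc (toℕ j) % (3 + k))

PathAdj : (c : ℕ) → Fin c → Fin c → Set
PathAdj c i j = (toℕ j ≡ suc (toℕ i)) ⊎ (toℕ i ≡ suc (toℕ j))

SkeletonIsCycle : ∀ {n} → Graph n → Set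
SkeletonIsCycle {n} G = Σ ℕ λ k → Σ (Fin (3 + k) → Fin n) λ f →
  EnumSkel G f × (∀ i j → (adj G (f i) (f j) ≡ true → CycAdj k i j) ×
                          (CycAdj k i j → adj G (f i) (f j) ≡ true))

SkeletonIsPath : ∀ {n} → Graph n → Set
SkeletonIsPath {n} G = Σ ℕ λ c → Σ (Fin c → Fin n) λ f →
  EnumSkel G f × (∀ i j → (adj G (f i) (f j) ≡ true → PathAdj c i j) ×
                          (PathAdj c i j → adj G (f i) (f j) ≡ true))

Sunshine : ∀ {n} → Graph n → Set
Sunshine G = Connected G × SkeletonIsCycle G

Caterpillar : ∀ {n} → Graph n → Set
Caterpillar G = Connected G × SkeletonIsPath G

-- Common cards: b(G,H) ≥ k  iff there are k distinct cards of G and k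
-- distinct cards of H matched in isomorphic pairs (multiset intersection
-- of the decks has size ≥ k).

CommonCards : ∀ {n} → Graph (suc n) → Graph (suc n) → ℕ → Set
CommonCards {n} G H k =
  Σ (Fin k → Fin (suc n)) λ f → Σ (Fin k → Fin (suc n)) λ g →
    Injective _≡_ _≡_ f × Injective _≡_ _≡_ g × (∀ i → del G (f i) ≅ del H (g i))

SupercardVia : ∀ {n} → Graph (suc n) → Graph (suc n) →
               Graph (suc (suc n)) → Fin (suc (suc n)) → Fin (suc (suc n)) → Set
SupercardVia U T U⁺ w v = (del U⁺ w ≅ U) × (del U⁺ v ≅ T)

module _ {N : ℕ} (G : Graph N) (w v : Fin N) where

  -- λ ∈ B_vw(U⁺):  λ is an isomorphism from U - λ⁻¹(v) = U⁺ - {w, λ⁻¹(v)}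
  -- onto T - λ(w) = U⁺ - {v, λ(w)}
  InBvw : Permutation′ N → Set
  InBvw σ = ∀ x y → x ≢ w → σ ⟨$⟩ʳ x ≢ v → y ≢ w → σ ⟨$⟩ʳ y ≢ v →
            adj G x y ≡ adj G (σ ⟨$⟩ʳ x) (σ ⟨$⟩ʳ y)

  -- λ ∈ B_U: additionally λ is an isomorphism from U = U⁺ - w onto U⁺ - λ(w)
  InBU : Permutation′ N → Set
  InBU σ = InBvw σ × (∀ x y → x ≢ w → y ≢ w →
                      adj G x y ≡ adj G (σ ⟨$⟩ʳ x) (σ ⟨$⟩ʳ y))

  inBU? : ∀ σ → Dec (InBU σ)
  inBU? σ =
    all? (λ x → all? (λ y →
      ¬? (x ≟ w) →-dec ¬? ((σ ⟨$⟩ʳ x) ≟ v) →-dec ¬? (y ≟ w) →-dec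
      ¬? ((σ ⟨$⟩ʳ y) ≟ v) →-dec (adj G x y BoolP.≟ adj G (σ ⟨$⟩ʳ x) (σ ⟨$⟩ʳ y))))
    ×-dec
    all? (λ x → all? (λ y →
      ¬? (x ≟ w) →-dec ¬? (y ≟ w) →-dec
      (adj G x y BoolP.≟ adj G (σ ⟨$⟩ʳ x) (σ ⟨$⟩ʳ y))))

  _≈ₚ_ : Permutation′ N → Permutation′ N → Set
  σ ≈ₚ τ = ∀ x → σ ⟨$⟩ʳ x ≡ τ ⟨$⟩ʳ x

  Compatible : Permutation′ N → Permutation′ N → Set
  Compatible σ τ = (σ ⟨$⟩ˡ v ≢ τ ⟨$⟩ˡ v) × (σ ⟨$⟩ʳ w ≢ τ ⟨$⟩ʳ w)

  -- A set X ⊆ B_vw(U⁺), given as a family X : Fin m → Sym(V(U⁺));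
  -- condition (2) forces its entries to be pairwise distinct, so |X| = m.
  record MaxSaturating (m : ℕ) (X : Fin m → Permutation′ N) : Set where
    field
      inB      : ∀ i → InBvw (X i)
      hasId    : ∃ λ i → ∀ x → X i ⟨$⟩ʳ x ≡ x
      distinct : ∀ i j → i ≢ j → Compatible (X i) (X j)
      maximal  : ∀ σ → InBvw σ → (∀ i → ¬ (σ ≈ₚ X i)) →
                 ¬ (∀ i → Compatible σ (X i))

  countXU : (m : ℕ) → (Fin m → Permutation′ N) → ℕ
  countXU m X = length (filter (λ i → inBU? (X i)) (allFin m))

  IsChi : ℕ → Set
  IsChi c = (Σ ℕ λ m → Σ (Fin m → Permutation′ N) λ X →
               MaxSaturating m X × (countXU m X ≡ c)) ×
            (∀ m X → MaxSaturating m X → countXU m X ≤ c)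

{-# OPTIONS --safe #-}

-- If U - u ≅ T - t, then u lies on the cycle of U, and t is either an end of the skeleton path
-- of T or a leaf, in which case u has degree two.  Fix a leaf ℓ, ℓ′ at each end a, a′ of the
-- skeleton path; at most four common cards have t ∈ {a, a′, ℓ, ℓ′}.  For any other one the two
-- neighbours of u go to a or a leaf at a, and to a′ or a leaf at a′; exchanging leaves, they go
-- to a or ℓ and to a′ or ℓ′.  Joining a new vertex v to these two vertices of T gives a sunshine
-- supercard Z of T and U, with an isomorphism U → Z - t that sends u to v.  Comparing skeleton
-- sizes, the choice at one end determines that at the other, so only two graphs Z occur.
-- The common cards belonging to one Z form a compatible family in B_U, so by the maximality
-- of χ there are at most χ of them, whence b(U,T) ≤ 2χ + 4.

module Submission where

open import Defs
open import Data.Nat using (ℕ; zero; suc; _+_; _*_; _≤_; _<_; _∸_; _%_; z≤n; s≤s; _≤?_; _<?_)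
open import Data.Nat.Properties using (≤-refl; ≤-trans; ≤-reflexive; ≤-total; ≤-antisym; +-mono-≤; +-comm; +-identityʳ; m≤m+n; m≤n+m; suc-injective; 1+n≰n; ≰⇒>; <⇒≤; n≤1+n; +-suc; ≤-pred; ∸-cancelʳ-≤; <-cmp; +-monoʳ-≤; module ≤-Reasoning)
open import Data.Nat.DivMod using (m<n⇒m%n≡m; n%n≡0; m%n<n)
open import Data.Nat.ListAction using (sum)
open import Data.Fin using (Fin; zero; suc; toℕ; fromℕ; fromℕ<; inject₁; punchIn; opposite; _≟_)
open import Data.Fin.Properties using (toℕ-injective; toℕ<n; toℕ-fromℕ; toℕ-inject₁; toℕ-fromℕ<; punchIn-punchOut; injective⇒≤; any?; opposite-prop; opposite-involutive) renaming (suc-injective to Fin-suc-injective)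
open import Data.Fin.Induction using (<-weakInduction)
open import Data.Fin.Permutation using (Permutation′; _⟨$⟩ʳ_; _⟨$⟩ˡ_; inverseˡ; inverseʳ; flip; _∘ₚ_; transpose; lift₀; insert; insert-punchIn; remove; punchIn-permute)
import Data.Fin.Permutation as Perm
open import Data.Bool using (Bool; true; false; if_then_else_; _∨_)
import Data.Bool.Properties as Boolₚ
open import Data.List as List using (length; filter; tabulate; allFin)
open import Data.List.Properties using (map-tabulate; length-filter; length-tabulate; filter-all)
open import Data.List.Relation.Unary.All.Properties using (tabulate⁺)
open import Data.Product using (∃; ∃₂; _×_; _,_; proj₁; proj₂)
open import Data.Sum using (_⊎_; inj₁; inj₂; [_,_]′)
open import Data.Empty using (⊥; ⊥-elim)
open import Data.Vec.Functional using (_∷_)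
open import Function using (_∘_; id; Injective; case_of_)
open import Relation.Nullary using (¬_; Dec; yes; no)
open import Relation.Nullary.Decidable using (decidable-stable; dec-yes; dec-no; does)
open import Relation.Binary.Definitions using (tri<; tri≈; tri>)
open import Relation.Binary.Construct.Closure.ReflexiveTransitive using (Star; ε; _◅_; _◅◅_; reverse)
open import Relation.Binary.PropositionalEquality using (_≡_; _≢_; refl; trans; cong; cong₂; subst; subst₂; module ≡-Reasoning) renaming (sym to ≡-sym)

-- Permutations, transpositions and edges

perm-injective : ∀ {n} (π : Permutation′ n) → Injective _≡_ _≡_ (π ⟨$⟩ʳ_)
perm-injective π {x} {y} eq = trans (≡-sym (inverseˡ π)) (trans (cong (π ⟨$⟩ˡ_) eq) (inverseˡ π))

transpose-eqˡ : ∀ {n} (i j : Fin n) → transpose i j ⟨$⟩ʳ i ≡ j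
transpose-eqˡ i j rewrite proj₂ (dec-yes (i ≟ i) refl) = refl

transpose-eqʳ : ∀ {n} (i j : Fin n) → transpose i j ⟨$⟩ʳ j ≡ i
transpose-eqʳ i j with j ≟ i
... | yes j≡i = j≡i
... | no _ rewrite proj₂ (dec-yes (j ≟ j) refl) = refl

transpose-other : ∀ {n} {i j k : Fin n} → k ≢ i → k ≢ j → transpose i j ⟨$⟩ʳ k ≡ k
transpose-other {i = i} {j} {k} k≢i k≢j
  rewrite dec-no (k ≟ i) k≢i | dec-no (k ≟ j) k≢j = refl

Edge : ∀ {n} → Graph n → Fin n → Fin n → Set
Edge G x y = adj G x y ≡ true

edge-sym : ∀ {n} (G : Graph n) {x y} → Edge G x y → Edge G y x
edge-sym G {x} {y} e = trans (sym G y x) e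

edge-≢ : ∀ {n} (G : Graph n) {x y} → Edge G x y → x ≢ y
edge-≢ G {x} e refl = case trans (≡-sym e) (irref G x) of λ ()

bool-ext : ∀ {a b : Bool} → (a ≡ true → b ≡ true) → (b ≡ true → a ≡ true) → a ≡ b
bool-ext {true}  {b}     f g = ≡-sym (f refl)
bool-ext {false} {true}  f g = g refl
bool-ext {false} {false} f g = refl

-- Degree at least two

trues : ∀ {n} → (Fin n → Bool) → ℕ
trues b = sum (tabulate (λ i → if b i then 1 else 0))

1≤trues⁻ : ∀ {n} (b : Fin n → Bool) → 1 ≤ trues b → ∃ λ i → b i ≡ true
1≤trues⁻ {suc n} b p with b zero in eq
... | true  = zero , eq
... | false = let i , q = 1≤trues⁻ (b ∘ suc) p in suc i , q

1≤trues⁺ : ∀ {n} (b : Fin n → Bool) i → b i ≡ true → 1 ≤ trues b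
1≤trues⁺ b zero    q rewrite q = s≤s z≤n
1≤trues⁺ b (suc i) q = ≤-trans (1≤trues⁺ (b ∘ suc) i q) (m≤n+m _ _)

2≤trues⁻ : ∀ {n} (b : Fin n → Bool) → 2 ≤ trues b → ∃₂ λ i j → i ≢ j × b i ≡ true × b j ≡ true
2≤trues⁻ {suc n} b p with b zero in eq
... | true  = let j , q = 1≤trues⁻ (b ∘ suc) (≤-pred p) in zero , suc j , (λ ()) , eq , q
... | false = let i , j , i≢j , qi , qj = 2≤trues⁻ (b ∘ suc) p
              in suc i , suc j , i≢j ∘ Fin-suc-injective , qi , qj

2≤trues⁺ : ∀ {n} (b : Fin n → Bool) i j → i ≢ j → b i ≡ true → b j ≡ true → 2 ≤ trues b
2≤trues⁺ b zero    zero    i≢j p q = ⊥-elim (i≢j refl)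
2≤trues⁺ b zero    (suc j) i≢j p q rewrite p = s≤s (1≤trues⁺ (b ∘ suc) j q)
2≤trues⁺ b (suc i) zero    i≢j p q rewrite q = s≤s (1≤trues⁺ (b ∘ suc) i p)
2≤trues⁺ b (suc i) (suc j) i≢j p q =
  ≤-trans (2≤trues⁺ (b ∘ suc) i j (i≢j ∘ cong suc) p q) (m≤n+m _ _)

deg-trues : ∀ {n} (G : Graph n) x → deg G x ≡ trues (adj G x)
deg-trues G x = cong sum (map-tabulate id (λ y → if adj G x y then 1 else 0))

skel⁻ : ∀ {n} (G : Graph n) {x} → InSkel G x → ∃₂ λ y z → y ≢ z × Edge G x y × Edge G x z
skel⁻ G {x} s = 2≤trues⁻ (adj G x) (subst (2 ≤_) (deg-trues G x) s)

skel⁺ : ∀ {n} (G : Graph n) {x y z} → y ≢ z → Edge G x y → Edge G x z → InSkel G x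
skel⁺ G {x} y≢z e f = subst (2 ≤_) (≡-sym (deg-trues G x)) (2≤trues⁺ (adj G x) _ _ y≢z e f)

skel? : ∀ {n} (G : Graph n) x → Dec (InSkel G x)
skel? G x = 2 ≤? deg G x

leaf-unique : ∀ {n} (G : Graph n) {x y z} → ¬ InSkel G x → Edge G x y → Edge G x z → y ≡ z
leaf-unique G {x} {y} {z} ¬s e f with y ≟ z
... | yes eq = eq
... | no y≢z = ⊥-elim (¬s (skel⁺ G y≢z e f))

-- Connectedness

connected-induction : ∀ {n} (G : Graph n) → Connected G → (P : Fin n → Set) →
  (∀ {x y} → P x → Edge G x y → P y) → ∀ {x} → P x → ∀ y → P y
connected-induction G con P step {x} px y with con x y
... | k , p , refl , refl , es = <-weakInduction (P ∘ p) px (λ i q → step q (es i)) (fromℕ k)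

star⇒walk : ∀ {n} (G : Graph n) {x y} → Star (Edge G) x y → ∃ (Walk G x y)
star⇒walk G {x} ε = 0 , (λ _ → x) , refl , refl , λ ()
star⇒walk G {x} (e ◅ s) with star⇒walk G s
... | k , p , refl , q , es = suc k , (x ∷ p) , refl , q , λ { zero → e ; (suc i) → es i }

has-neighbour : ∀ {n} (G : Graph n) → Connected G → ∀ {x y} → x ≢ y → ∃ (Edge G x)
has-neighbour G con {x} {y} x≢y with any? (λ z → adj G x z Boolₚ.≟ true)
... | yes found = found
... | no none = ⊥-elim (x≢y (≡-sym (connected-induction G con (_≡ x)
                  (λ { refl e → ⊥-elim (none (_ , e)) }) refl y)))

-- If `y` had no neighbour besides `x`, then `x` and `y` would form a set closed under adjacency. By
-- connectedness this set would be the whole graph, which has at least three vertices.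
leaf-neighbour : ∀ {n} (G : Graph n) → Connected G → 3 ≤ n →
  ∀ {x y} → ¬ InSkel G x → Edge G x y → InSkel G y
leaf-neighbour G con 3≤n {x} {y} ¬sx e = decidable-stable (skel? G y) λ ¬sy →
  third ¬sy 3≤n
  where
  both : ¬ InSkel G y → ∀ z → z ≡ x ⊎ z ≡ y
  both ¬sy = connected-induction G con (λ z → z ≡ x ⊎ z ≡ y)
    (λ { (inj₁ refl) f → inj₂ (leaf-unique G ¬sx f e)
       ; (inj₂ refl) f → inj₁ (leaf-unique G ¬sy f (edge-sym G e)) }) (inj₁ refl)
  index : ∀ {z} → z ≡ x ⊎ z ≡ y → Fin 2
  index (inj₁ _) = zero
  index (inj₂ _) = suc zero
  index-inj : ∀ {z z′} (p : z ≡ x ⊎ z ≡ y) (q : z′ ≡ x ⊎ z′ ≡ y) → index p ≡ index q → z ≡ z′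
  index-inj (inj₁ refl) (inj₁ refl) _ = refl
  index-inj (inj₂ refl) (inj₂ refl) _ = refl
  third : ¬ InSkel G y → 3 ≤ _ → ⊥
  third ¬sy p = 1+n≰n (≤-trans p (injective⇒≤
    (λ {z} {z′} → index-inj (both ¬sy z) (both ¬sy z′))))

-- Isomorphisms of cards as permutations of all vertices

-- Matching the two deleted vertices with each other turns an isomorphism of cards into a
-- permutation of the full vertex set, which can be composed with automorphisms of `T`.
CardIso : ∀ {n} → Graph (suc n) → Graph (suc n) → Fin (suc n) → Fin (suc n) → Permutation′ (suc n) → Set
CardIso U T u t σ = σ ⟨$⟩ʳ u ≡ t ×
  (∀ x y → x ≢ u → y ≢ u → adj U x y ≡ adj T (σ ⟨$⟩ʳ x) (σ ⟨$⟩ʳ y))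

insert-self : ∀ {n} (i j : Fin (suc n)) (π : Permutation′ n) → insert i j π ⟨$⟩ʳ i ≡ j
insert-self i j π rewrite proj₂ (dec-yes (i ≟ i) refl) = refl

extend-card : ∀ {n} (U T : Graph (suc n)) {u t} → del U u ≅ del T t → ∃ (CardIso U T u t)
extend-card U T {u} {t} (π , iso) = insert u t π , insert-self u t π , λ x y x≢u y≢u →
  subst₂ (λ x y → adj U x y ≡ adj T (insert u t π ⟨$⟩ʳ x) (insert u t π ⟨$⟩ʳ y))
    (punchIn-punchOut (x≢u ∘ ≡-sym)) (punchIn-punchOut (y≢u ∘ ≡-sym))
    (trans (iso _ _) (≡-sym (cong₂ (adj T) (insert-punchIn u t π _) (insert-punchIn u t π _))))

-- Cycles

IsCycle : ∀ {n} → Graph n → (k : ℕ) → (Fin (3 + k) → Fin n) → Set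
IsCycle G k f = EnumSkel G f × (∀ i j → (adj G (f i) (f j) ≡ true → CycAdj k i j) ×
                                        (CycAdj k i j → adj G (f i) (f j) ≡ true))

next : ∀ {n} → Fin (suc n) → Fin (suc n)
next {n} i = fromℕ< (m%n<n (suc (toℕ i)) (suc n))

prev : ∀ {n} → Fin (suc n) → Fin (suc n)
prev {n} zero = fromℕ n
prev (suc i)  = inject₁ i

toℕ-next : ∀ {n} (i : Fin (suc n)) → toℕ (next i) ≡ suc (toℕ i) % suc n
toℕ-next {n} i = toℕ-fromℕ< (m%n<n (suc (toℕ i)) (suc n))

suc%-cases : ∀ {n} (i : Fin (suc n)) → (suc (toℕ i) % suc n ≡ suc (toℕ i)) ⊎
                                       (suc (toℕ i) % suc n ≡ 0 × toℕ i ≡ n)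
suc%-cases {n} i with suc (toℕ i) <? suc n
... | yes p = inj₁ (m<n⇒m%n≡m p)
... | no ¬p = inj₂ (trans (cong (_% suc n) (cong suc eq)) (n%n≡0 (suc n)) , eq)
  where
  eq : toℕ i ≡ n
  eq = ≤-antisym (≤-pred (toℕ<n i)) (≤-pred (≤-pred (≰⇒> ¬p)))

next-prev : ∀ {n} (i : Fin (suc n)) → next (prev i) ≡ i
next-prev {n} zero = toℕ-injective (trans (toℕ-next (fromℕ n))
  (trans (cong (λ m → suc m % suc n) (toℕ-fromℕ n)) (n%n≡0 (suc n))))
next-prev {n} (suc i) = toℕ-injective (trans (toℕ-next (inject₁ i))
  (trans (cong (λ m → suc m % suc n) (toℕ-inject₁ i)) (m<n⇒m%n≡m (s≤s (toℕ<n i)))))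

next-injective : ∀ {n} → Injective _≡_ _≡_ (next {n})
next-injective {n} {i} {j} eq with suc%-cases i | suc%-cases j
                                 | trans (≡-sym (toℕ-next i)) (trans (cong toℕ eq) (toℕ-next j))
... | inj₁ p       | inj₁ q       | r = toℕ-injective (suc-injective (trans (≡-sym p) (trans r q)))
... | inj₂ (_ , p) | inj₂ (_ , q) | r = toℕ-injective (trans p (≡-sym q))
... | inj₁ p       | inj₂ (q , _) | r = case trans (≡-sym p) (trans r q) of λ ()
... | inj₂ (p , _) | inj₁ q       | r = case trans (≡-sym p) (trans r q) of λ ()

cycAdj-next⁺ : ∀ {k} {i j : Fin (3 + k)} → CycAdj k i j → CycAdj k (next i) (next j)
cycAdj-next⁺ {k} {i} {j} (inj₁ p) = inj₁ (trans (toℕ-next j) (cong (λ m → suc m % (3 + k)) (trans p (≡-sym (toℕ-next i)))))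
cycAdj-next⁺ {k} {i} {j} (inj₂ p) = inj₂ (trans (toℕ-next i) (cong (λ m → suc m % (3 + k)) (trans p (≡-sym (toℕ-next j)))))

cycAdj-next⁻ : ∀ {k} {i j : Fin (3 + k)} → CycAdj k (next i) (next j) → CycAdj k i j
cycAdj-next⁻ {k} {i} {j} (inj₁ p) = inj₁ (trans
  (cong toℕ (next-injective (toℕ-injective (trans p (≡-sym (toℕ-next (next i))))))) (toℕ-next i))
cycAdj-next⁻ {k} {i} {j} (inj₂ p) = inj₂ (trans
  (cong toℕ (next-injective (toℕ-injective (trans p (≡-sym (toℕ-next (next j))))))) (toℕ-next j))

IsCycle-next : ∀ {n k} (G : Graph n) (f : Fin (3 + k) → Fin n) → IsCycle G k f → IsCycle G k (f ∘ next)
IsCycle-next G f ((inj , skel , surj) , adjs) =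
  ( (λ eq → next-injective (inj eq)) , (λ i → skel (next i))
  , λ x s → let i , eq = surj x s in prev i , trans (cong f (next-prev i)) eq) ,
  λ i j → (cycAdj-next⁻ ∘ proj₁ (adjs (next i) (next j))) , (proj₂ (adjs (next i) (next j)) ∘ cycAdj-next⁺)

rotate-to : ∀ {n k} (G : Graph n) (f : Fin (3 + k) → Fin n) → IsCycle G k f → (p : Fin (3 + k)) →
  ∃ λ f′ → IsCycle G k f′ × f′ zero ≡ f p
rotate-to {k = k} G f cyc p = go (toℕ p) f cyc p refl
  where
  -- The recursion is on `m` because `inject₁ p` is not a subterm of `suc p`; each round rotates the
  -- labelling by one place.
  go : ∀ m f → IsCycle G k f → (p : Fin (3 + k)) → toℕ p ≡ m → ∃ λ f′ → IsCycle G k f′ × f′ zero ≡ f p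
  go m       f cyc zero    eq = _ , cyc , refl
  go (suc m) f cyc (suc p) eq with go m (f ∘ next) (IsCycle-next G f cyc) (inject₁ p)
                                      (trans (toℕ-inject₁ p) (suc-injective eq))
  ... | f′ , cyc′ , eq′ = f′ , cyc′ , trans eq′ (cong f (next-prev (suc p)))

-- The cycle cut open at `u`: what remains is an induced path, and `u` sees only its two ends.
-- Leaves at `u` are still possible at this stage.
record Opened {n} (G : Graph n) (k : ℕ) (u : Fin n) : Set where
  field
    path      : Fin (2 + k) → Fin n
    injective : Injective _≡_ _≡_ path
    avoids    : ∀ i → path i ≢ u
    covers    : ∀ x → InSkel G x → x ≢ u → ∃ λ i → path i ≡ x
    adj⁻      : ∀ {i j} → Edge G (path i) (path j) → PathAdj (2 + k) i j
    adj⁺      : ∀ {i j} → PathAdj (2 + k) i j → Edge G (path i) (path j)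
    root⁻     : ∀ {i} → Edge G u (path i) → i ≡ zero ⊎ i ≡ fromℕ (suc k)
    first     : Edge G u (path zero)
    last      : Edge G u (path (fromℕ (suc k)))

open-cycle : ∀ {n k} (G : Graph n) (f : Fin (3 + k) → Fin n) → IsCycle G k f → ∀ {u} → InSkel G u → Opened G k u
open-cycle {k = k} G f cyc {u} su with proj₂ (proj₂ (proj₁ cyc)) u su
... | p , fp≡u with rotate-to G f cyc p
... | f , ((inj , skel , surj) , adjs) , f0≡fp with trans f0≡fp fp≡u
... | refl = record
  { path = f ∘ suc
  ; injective = λ eq → Fin-suc-injective (inj eq)
  ; avoids = λ i eq → case inj eq of λ ()
  ; covers = λ x s x≢u → case surj x s of λ
      { (zero , refl) → ⊥-elim (x≢u refl) ; (suc i , eq) → i , eq }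
  ; adj⁻ = λ {i} {j} e → fromCyc (proj₁ (adjs (suc i) (suc j)) e)
  ; adj⁺ = λ {i} {j} a → proj₂ (adjs (suc i) (suc j)) (toCyc a)
  ; root⁻ = λ {i} e → fromRoot (proj₁ (adjs zero (suc i)) e)
  ; first = proj₂ (adjs zero (suc zero)) (inj₁ refl)
  ; last = proj₂ (adjs zero (suc (fromℕ (suc k)))) (inj₂ (≡-sym (trans
      (cong (λ m → suc (suc m) % (3 + k)) (toℕ-fromℕ (suc k))) (n%n≡0 (3 + k)))))
  }
  where
  one : ∀ {i j : Fin (2 + k)} → suc (toℕ j) ≡ suc (suc (toℕ i)) % (3 + k) → toℕ j ≡ suc (toℕ i)
  one {i} {j} eq with suc%-cases (Fin.suc i)
  ... | inj₁ p = suc-injective (trans eq p)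
  ... | inj₂ (p , _) = case trans eq p of λ ()
  fromCyc : ∀ {i j : Fin (2 + k)} → CycAdj k (suc i) (suc j) → PathAdj (2 + k) i j
  fromCyc (inj₁ p) = inj₁ (one p)
  fromCyc (inj₂ p) = inj₂ (one p)
  up : ∀ {i j : Fin (2 + k)} → toℕ j ≡ suc (toℕ i) → suc (toℕ j) ≡ suc (suc (toℕ i)) % (3 + k)
  up {i} {j} eq = trans (cong suc eq) (≡-sym (m<n⇒m%n≡m (s≤s (subst (_< 2 + k) eq (toℕ<n j)))))
  toCyc : ∀ {i j : Fin (2 + k)} → PathAdj (2 + k) i j → CycAdj k (suc i) (suc j)
  toCyc (inj₁ p) = inj₁ (up p)
  toCyc (inj₂ p) = inj₂ (up p)
  fromRoot : ∀ {i : Fin (2 + k)} → CycAdj k zero (suc i) → i ≡ zero ⊎ i ≡ fromℕ (suc k)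
  fromRoot (inj₁ p) = inj₁ (toℕ-injective (suc-injective p))
  fromRoot {i} (inj₂ p) with suc%-cases (Fin.suc i)
  ... | inj₁ q = case trans p q of λ ()
  ... | inj₂ (_ , q) = inj₂ (toℕ-injective (trans (suc-injective q) (≡-sym (toℕ-fromℕ (suc k)))))

-- The skeleton path of a caterpillar

argmax : ∀ {c} (g : Fin (suc c) → ℕ) → ∃ λ i → ∀ j → g j ≤ g i
argmax {zero}  g = zero , λ { zero → ≤-refl }
argmax {suc c} g with argmax (g ∘ suc)
... | i , top with ≤-total (g zero) (g (suc i))
... | inj₁ p = suc i , λ { zero → p ; (suc j) → top j }
... | inj₂ p = zero , λ { zero → ≤-refl ; (suc j) → ≤-trans (top j) p }

-- Here the length at least three matters: on two vertices the successor and the predecessor would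
-- coincide.
next≢prev : ∀ {k} (i : Fin (3 + k)) → next i ≢ prev i
next≢prev {k} zero eq = case trans (cong toℕ eq) (toℕ-fromℕ (2 + k)) of λ ()
next≢prev {k} (suc i) eq with suc%-cases (Fin.suc i)
                           | trans (≡-sym (toℕ-next (Fin.suc i))) (trans (cong toℕ eq) (toℕ-inject₁ i))
... | inj₁ p       | r = 1+n≰n (≤-trans (n≤1+n _) (≤-reflexive (trans (≡-sym p) r)))
... | inj₂ (p , q) | r = case trans (≡-sym (suc-injective q)) (trans (≡-sym r) p) of λ ()

cycAdj-next : ∀ {k} (i : Fin (3 + k)) → CycAdj k i (next i)
cycAdj-next i = inj₁ (toℕ-next i)

cycAdj-prev : ∀ {k} (i : Fin (3 + k)) → CycAdj k i (prev i)
cycAdj-prev i = inj₂ (trans (cong toℕ (≡-sym (next-prev i))) (toℕ-next (prev i)))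

-- `Side` is a union of components of `T - t`. An edge is required within it and another outside it,
-- since an edge of `U - u` always meets the opened cycle whereas a single vertex may miss it.
record Separates {n} (T : Graph n) (t : Fin n) : Set₁ where
  field
    Side       : Fin n → Set
    closed     : ∀ {x y} → Side x → Edge T x y → y ≢ t → Side y
    {p p′ q q′} : Fin n
    edgeᵖ      : Edge T p p′
    edge^q     : Edge T q q′
    p≢t        : p ≢ t
    p′≢t       : p′ ≢ t
    q≢t        : q ≢ t
    q′≢t       : q′ ≢ t
    inside     : Side p
    outside    : ¬ Side q

-- "At most one": the centre of a star, with no skeleton neighbour, also qualifies.
OneSkelNeighbour : ∀ {n} → Graph n → Fin n → Set
OneSkelNeighbour T r = ∀ {y z} → Edge T r y → Edge T r z → InSkel T y → InSkel T z → y ≡ z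

-- For a star `a` and `a′` coincide, but `ℓ` and `ℓ′` are always different. The field `core` ensures
-- that deleting any leaf other than `ℓ` and `ℓ′` leaves the skeleton unchanged.
record Ends {n} (T : Graph n) : Set₁ where
  field
    a a′ ℓ ℓ′ : Fin n
    skelˡ  : InSkel T a
    skelʳ  : InSkel T a′
    edgeˡ  : Edge T a ℓ
    edgeʳ  : Edge T a′ ℓ′
    leafˡ  : ¬ InSkel T ℓ
    leafʳ  : ¬ InSkel T ℓ′
    ℓ≢ℓ′   : ℓ ≢ ℓ′
    isEnd  : ∀ {r} → InSkel T r → OneSkelNeighbour T r → r ≡ a ⊎ r ≡ a′
    core   : ∀ {s} → InSkel T s → ∃₂ λ y z → y ≢ z × (Edge T s y × (InSkel T y ⊎ y ≡ ℓ ⊎ y ≡ ℓ′)) ×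
                                                     (Edge T s z × (InSkel T z ⊎ z ≡ ℓ ⊎ z ≡ ℓ′))
    interior-separates : ∀ {t} → InSkel T t → t ≡ a ⊎ t ≡ a′ ⊎ Separates T t

module PathSkeleton {n} (T : Graph n) {m} (e : Fin m → Fin n) (enum : EnumSkel T e)
                    (adjs : ∀ i j → (adj T (e i) (e j) ≡ true → PathAdj m i j) ×
                                    (PathAdj m i j → adj T (e i) (e j) ≡ true)) where

  e-injective : Injective _≡_ _≡_ e
  e-injective = proj₁ enum

  e-skel : ∀ i → InSkel T (e i)
  e-skel = proj₁ (proj₂ enum)

  index : ∀ {x} → InSkel T x → ∃ λ i → e i ≡ x
  index = proj₂ (proj₂ enum) _

  -- Every vertex of a cycle has degree at least two, so the cycle runs inside the skeleton path. At
  -- its vertex of highest index both cycle neighbours have index one less, so they coincide.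
  no-cycle : ∀ k (h : Fin (3 + k) → Fin n) → Injective _≡_ _≡_ h →
             (∀ i j → CycAdj k i j → Edge T (h i) (h j)) → ⊥
  no-cycle k h h-inj h-adj =
    let i , top = argmax (λ i → toℕ (proj₁ (at i))) in not-highest i top
    where
    at : ∀ i → ∃ λ j → e j ≡ h i
    at i = index (skel⁺ T (next≢prev i ∘ h-inj) (h-adj i (next i) (cycAdj-next i)) (h-adj i (prev i) (cycAdj-prev i)))
    not-highest : ∀ i → (∀ j → toℕ (proj₁ (at j)) ≤ toℕ (proj₁ (at i))) → ⊥
    not-highest i top = next≢prev i (h-inj (trans (≡-sym (proj₂ (at (next i)))) (trans (cong e eq) (proj₂ (at (prev i))))))
      where
      below : ∀ j → CycAdj k i j → toℕ (proj₁ (at i)) ≡ suc (toℕ (proj₁ (at j)))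
      below j c with proj₁ (adjs (proj₁ (at i)) (proj₁ (at j))) (subst₂ (Edge T) (≡-sym (proj₂ (at i))) (≡-sym (proj₂ (at j))) (h-adj i j c))
      ... | inj₂ eq = eq
      ... | inj₁ eq = ⊥-elim (1+n≰n (≤-trans (≤-reflexive (≡-sym eq)) (top j)))
      eq : proj₁ (at (next i)) ≡ proj₁ (at (prev i))
      eq = toℕ-injective (suc-injective (trans (≡-sym (below (next i) (cycAdj-next i))) (below (prev i) (cycAdj-prev i))))

position : ∀ {m} (j : Fin (suc m)) → j ≡ zero ⊎ j ≡ fromℕ m ⊎
           ∃₂ λ (i i⁺ : Fin (suc m)) → toℕ j ≡ suc (toℕ i) × toℕ i⁺ ≡ suc (toℕ j)
position zero = inj₁ refl
position {m} (suc i) with suc%-cases (Fin.suc i)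
... | inj₂ (_ , q) = inj₂ (inj₁ (toℕ-injective (trans q (≡-sym (toℕ-fromℕ m)))))
... | inj₁ p = inj₂ (inj₂ (inject₁ i , next (suc i) , cong suc (≡-sym (toℕ-inject₁ i)) ,
                 trans (toℕ-next (Fin.suc i)) p))

two-apart : ∀ {m} {i i⁺ : Fin m} {j : ℕ} → j ≡ suc (toℕ i) → toℕ i⁺ ≡ suc j → i ≢ i⁺
two-apart p q refl = 1+n≰n (≤-trans (s≤s (n≤1+n _)) (≤-reflexive (≡-sym (trans q (cong suc p)))))

-- Of two distinct neighbours of `r` at most one is in the skeleton.
leaf-at-end : ∀ {n} (T : Graph n) {r} → InSkel T r → OneSkelNeighbour T r →
              ∃ λ ℓ → Edge T r ℓ × ¬ InSkel T ℓ
leaf-at-end T s one with skel⁻ T s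
... | y , z , y≢z , ey , ez with skel? T y | skel? T z
... | no ¬y | _     = y , ey , ¬y
... | yes _ | no ¬z = z , ez , ¬z
... | yes p | yes q = ⊥-elim (y≢z (one ey ez p q))

module Nonempty {n} (T : Graph n) {m} (e : Fin (suc m) → Fin n) (enum : EnumSkel T e)
                (adjs : ∀ i j → (adj T (e i) (e j) ≡ true → PathAdj (suc m) i j) ×
                                (PathAdj (suc m) i j → adj T (e i) (e j) ≡ true)) where

  open PathSkeleton T e enum adjs

  isEnd : ∀ {r} → InSkel T r → OneSkelNeighbour T r → r ≡ e zero ⊎ r ≡ e (fromℕ m)
  isEnd s one with index s
  ... | j , refl with position j
  ... | inj₁ refl = inj₁ refl
  ... | inj₂ (inj₁ refl) = inj₂ refl
  ... | inj₂ (inj₂ (i , i⁺ , p , q)) = ⊥-elim (two-apart p q (e-injective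
          (one (proj₂ (adjs j i) (inj₂ p)) (proj₂ (adjs j i⁺) (inj₁ q)) (e-skel i) (e-skel i⁺))))

  firstOne : OneSkelNeighbour T (e zero)
  firstOne ey ez sy sz with index sy | index sz
  ... | i , refl | j , refl with proj₁ (adjs zero i) ey | proj₁ (adjs zero j) ez
  ... | inj₁ p | inj₁ q = cong e (toℕ-injective (trans p (≡-sym q)))

  lastOne : OneSkelNeighbour T (e (fromℕ m))
  lastOne ey ez sy sz with index sy | index sz
  ... | i , refl | j , refl = cong e (toℕ-injective (suc-injective
      (trans (≡-sym (below i ey)) (below j ez))))
    where
    below : ∀ i → Edge T (e (fromℕ m)) (e i) → toℕ (fromℕ m) ≡ suc (toℕ i)
    below i ei with proj₁ (adjs (fromℕ m) i) ei
    ... | inj₂ p = p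
    ... | inj₁ p = ⊥-elim (1+n≰n (≤-trans (≤-reflexive (trans (cong suc (≡-sym (toℕ-fromℕ m))) (≡-sym p)))
                                          (≤-pred (toℕ<n i))))

  interior-separates : ∀ {t} → InSkel T t → t ≡ e zero ⊎ t ≡ e (fromℕ m) ⊎ Separates T t
  interior-separates s with index s
  ... | j , refl with position j
  ... | inj₁ refl = inj₁ refl
  ... | inj₂ (inj₁ refl) = inj₂ (inj₁ refl)
  ... | inj₂ (inj₂ (i , i⁺ , p , q)) = inj₂ (inj₂ record
    { Side = Side
    ; closed = closed
    ; edgeᵖ = proj₁ (proj₂ (other (e-skel i)))
    ; edge^q = proj₁ (proj₂ (other (e-skel i⁺)))
    ; p≢t = λ eq → 1+n≰n (≤-reflexive (trans (≡-sym p) (cong toℕ (≡-sym (e-injective eq)))))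
    ; p′≢t = proj₂ (proj₂ (other (e-skel i)))
    ; q≢t = λ eq → 1+n≰n (≤-reflexive (trans (≡-sym q) (cong toℕ (e-injective eq))))
    ; q′≢t = proj₂ (proj₂ (other (e-skel i⁺)))
    ; inside = i , ≤-reflexive (≡-sym p) , inj₁ refl
    ; outside = λ
        { (i′ , lt , inj₁ eq) → 1+n≰n (≤-trans (s≤s (n≤1+n _)) (≤-trans (≤-reflexive (cong suc (trans (≡-sym q) (cong toℕ (e-injective eq))))) lt))
        ; (_ , _ , inj₂ (¬s , _)) → ¬s (e-skel i⁺) }
    })
    where
    -- This is the component of `T - e j` that contains the predecessor of `e j` on the skeleton
    -- path.
    Side : Fin n → Set
    Side x = ∃ λ i′ → toℕ i′ < toℕ j × (x ≡ e i′ ⊎ (¬ InSkel T x × Edge T (e i′) x))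
    other : ∀ {x} → InSkel T x → ∃ λ y → Edge T x y × y ≢ e j
    other sx with skel⁻ T sx
    ... | y , z , y≢z , ey , ez with y ≟ e j
    ... | no y≢ = y , ey , y≢
    ... | yes refl = z , ez , y≢z ∘ ≡-sym
    closed : ∀ {x y} → Side x → Edge T x y → y ≢ e j → Side y
    closed (i′ , lt , inj₂ (¬sx , ex)) exy y≢t = i′ , lt , inj₁ (leaf-unique T ¬sx exy (edge-sym T ex))
    closed {y = y} (i′ , lt , inj₁ refl) exy y≢t with skel? T y
    ... | no ¬sy = i′ , lt , inj₂ (¬sy , exy)
    ... | yes sy with index sy
    ... | j′ , refl with proj₁ (adjs i′ j′) exy
    ... | inj₂ r = j′ , ≤-trans (≤-trans (≤-reflexive (≡-sym r)) (n≤1+n _)) lt , inj₁ refl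
    ... | inj₁ r with <-cmp (toℕ j′) (toℕ j)
    ... | tri< l _ _ = j′ , l , inj₁ refl
    ... | tri≈ _ eq _ = ⊥-elim (y≢t (cong e (toℕ-injective eq)))
    ... | tri> _ _ g = ⊥-elim (1+n≰n (≤-trans g (≤-trans (≤-reflexive r) lt)))

someSkel : ∀ {n} (T : Graph n) → Connected T → 3 ≤ n → ∃ (InSkel T)
someSkel T con 3≤n@(s≤s (s≤s (s≤s _))) with has-neighbour T con {zero} {suc zero} (λ ()) | skel? T zero
... | _     | yes s = zero , s
... | y , f | no ¬s = y , leaf-neighbour T con 3≤n ¬s f

-- An empty skeleton is impossible for a connected graph on three or more vertices. A one-vertex
-- skeleton gives a star, where two leaves at the centre serve; otherwise each end of the path
-- supplies a leaf of its own.
ends : ∀ {n} (T : Graph n) → Connected T → 3 ≤ n → SkeletonIsPath T → Ends T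
ends T con 3≤n (zero , e , enum , adjs) =
  case proj₂ (proj₂ enum) _ (proj₂ (someSkel T con 3≤n)) of λ { (() , _) }
ends {n} T con 3≤n (suc zero , e , enum , adjs) = star (skel⁻ T (proj₁ (proj₂ enum) zero))
  where
  open Nonempty T e enum adjs
  allEqual : ∀ {x} → InSkel T x → e zero ≡ x
  allEqual s with proj₂ (proj₂ enum) _ s
  ... | zero , eq = eq
  star : (∃₂ λ y z → y ≢ z × Edge T (e zero) y × Edge T (e zero) z) → Ends T
  star (y , z , y≢z , ey , ez) = record
    { a = e zero ; a′ = e zero ; ℓ = y ; ℓ′ = z
    ; skelˡ = proj₁ (proj₂ enum) zero ; skelʳ = proj₁ (proj₂ enum) zero
    ; edgeˡ = ey ; edgeʳ = ez
    ; leafˡ = edge-≢ T ey ∘ allEqual ; leafʳ = edge-≢ T ez ∘ allEqual ; ℓ≢ℓ′ = y≢z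
    ; isEnd = isEnd
    ; core = λ s → y , z , y≢z
        , (subst (λ x → Edge T x y) (allEqual s) ey , inj₂ (inj₁ refl))
        , (subst (λ x → Edge T x z) (allEqual s) ez , inj₂ (inj₂ refl))
    ; interior-separates = interior-separates }
ends {n} T con 3≤n (suc (suc m) , e , enum , adjs) = record
  { a = e zero ; a′ = e (fromℕ (suc m)) ; ℓ = proj₁ L ; ℓ′ = proj₁ R
  ; skelˡ = e-skel zero ; skelʳ = e-skel (fromℕ (suc m))
  ; edgeˡ = proj₁ (proj₂ L) ; edgeʳ = proj₁ (proj₂ R)
  ; leafˡ = proj₂ (proj₂ L) ; leafʳ = proj₂ (proj₂ R)
  -- A leaf common to both ends would have two different neighbours.
  ; ℓ≢ℓ′ = λ eq → zero≢last (e-injective (leaf-unique T (proj₂ (proj₂ L))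
      (edge-sym T (proj₁ (proj₂ L)))
      (subst (λ x → Edge T x (e (fromℕ (suc m)))) (≡-sym eq) (edge-sym T (proj₁ (proj₂ R))))))
  ; isEnd = isEnd
  ; core = core
  ; interior-separates = interior-separates }
  where
  open PathSkeleton T e enum adjs
  open Nonempty T e enum adjs
  L = leaf-at-end T (e-skel zero) firstOne
  R = leaf-at-end T (e-skel (fromℕ (suc m))) lastOne
  zero≢last : Fin.zero ≢ fromℕ (suc m)
  zero≢last ()
  Joined : Fin n → Fin n → Set
  Joined s y = Edge T s y × (InSkel T y ⊎ y ≡ proj₁ L ⊎ y ≡ proj₁ R)
  joined : ∀ i j → PathAdj (2 + m) i j → Joined (e i) (e j)
  joined i j p = proj₂ (adjs i j) p , inj₁ (e-skel j)
  core : ∀ {s} → InSkel T s → ∃₂ λ y z → y ≢ z × Joined s y × Joined s z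
  core s with index s
  ... | j , refl with position j
  -- An end has only one skeleton neighbour; its chosen leaf is the second neighbour.
  ... | inj₁ refl = e (suc zero) , proj₁ L
      , (λ eq → proj₂ (proj₂ L) (subst (InSkel T) eq (e-skel _)))
      , joined zero (suc zero) (inj₁ refl) , (proj₁ (proj₂ L) , inj₂ (inj₁ refl))
  ... | inj₂ (inj₁ refl) = e (inject₁ (fromℕ m)) , proj₁ R
      , (λ eq → proj₂ (proj₂ R) (subst (InSkel T) eq (e-skel _)))
      , joined (fromℕ (suc m)) (inject₁ (fromℕ m)) (inj₂ (cong suc (≡-sym (toℕ-inject₁ (fromℕ m)))))
      , (proj₁ (proj₂ R) , inj₂ (inj₂ refl))
  ... | inj₂ (inj₂ (i , i⁺ , p , q)) = e i , e i⁺ , two-apart p q ∘ e-injective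
      , joined j i (inj₂ p) , joined j i⁺ (inj₁ q)

-- Reversing a path

∸-step : ∀ {m n} → n < m → m ∸ n ≡ suc (m ∸ suc n)
∸-step {suc m} {zero}  p       = refl
∸-step {suc m} {suc n} (s≤s p) = ∸-step p

opposite-pred : ∀ {c} {i j : Fin c} → toℕ j ≡ suc (toℕ i) → toℕ (opposite i) ≡ suc (toℕ (opposite j))
opposite-pred {c} {i} {j} eq = begin
  toℕ (opposite i)            ≡⟨ opposite-prop i ⟩
  c ∸ suc (toℕ i)             ≡⟨ ∸-step (subst (_< c) eq (toℕ<n j)) ⟩
  suc (c ∸ suc (suc (toℕ i))) ≡⟨ cong (λ m → suc (c ∸ suc m)) (≡-sym eq) ⟩
  suc (c ∸ suc (toℕ j))       ≡⟨ cong suc (≡-sym (opposite-prop j)) ⟩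
  suc (toℕ (opposite j))      ∎
  where open ≡-Reasoning

pathAdj-opposite : ∀ {c} {i j : Fin c} → PathAdj c i j → PathAdj c (opposite i) (opposite j)
pathAdj-opposite (inj₁ p) = inj₂ (opposite-pred p)
pathAdj-opposite (inj₂ p) = inj₁ (opposite-pred p)

opposite-≤⁻ : ∀ {c} {i j : Fin c} → toℕ (opposite i) ≤ toℕ (opposite j) → toℕ j ≤ toℕ i
opposite-≤⁻ {c} {i} {j} p = ≤-pred (∸-cancelʳ-≤ (toℕ<n j)
  (subst₂ _≤_ (opposite-prop i) (opposite-prop j) p))

-- Pendant vertices, and where a path enters the skeleton

NoCycle : ∀ {n} → Graph n → Set
NoCycle {n} T = ∀ k (h : Fin (3 + k) → Fin n) → Injective _≡_ _≡_ h →
                (∀ i j → CycAdj k i j → Edge T (h i) (h j)) → ⊥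

-- These are the possible positions of the image of a neighbour of `u` at the skeleton end `r`.
Near : ∀ {n} → Graph n → Fin n → Fin n → Set
Near T r s = s ≡ r ⊎ (¬ InSkel T s × Edge T r s)

-- The witnesses `y` and `z` keep `s` in the skeleton after `t` is deleted. As `t` has no other
-- neighbour, every skeleton vertex then survives, which is `skel-off`.
record Pendant {n} (G : Graph n) (t : Fin n) : Set where
  field
    {s y z} : Fin n
    edge    : Edge G t s
    unique  : ∀ {x} → Edge G t x → x ≡ s
    y≢z     : y ≢ z
    edgeʸ   : Edge G s y
    edgeᶻ   : Edge G s z
    y≢t     : y ≢ t
    z≢t     : z ≢ t

  notSkel : ¬ InSkel G t
  notSkel st with skel⁻ G st
  ... | p , q , p≢q , ep , eq = p≢q (trans (unique ep) (≡-sym (unique eq)))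

  skel-off : ∀ {x} → InSkel G x → ∃₂ λ p q → p ≢ q × (Edge G x p × p ≢ t) × (Edge G x q × q ≢ t)
  skel-off {x} sx with x ≟ s
  ... | yes refl = y , z , y≢z , (edgeʸ , y≢t) , (edgeᶻ , z≢t)
  ... | no x≢s with skel⁻ G sx
  ... | p , q , p≢q , ep , eq = p , q , p≢q
      , (ep , λ { refl → x≢s (unique (edge-sym G ep)) })
      , (eq , λ { refl → x≢s (unique (edge-sym G eq)) })

record FirstSkel {n} (T : Graph n) {c} (P : Fin (2 + c) → Fin n) : Set where
  field
    i       : Fin (2 + c)
    skel    : InSkel T (P i)
    one     : OneSkelNeighbour T (P i)
    near    : Near T (P i) (P zero)
    minimal : ∀ {j} → InSkel T (P j) → toℕ i ≤ toℕ j

-- If `P zero` is a leaf, then its neighbour `P (suc zero)` is in the skeleton, so the index found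
-- is 0 or 1. As the skeleton lies on `P`, only the successor along `P` can be a skeleton neighbour
-- of the vertex found.
first-skel : ∀ {n} (T : Graph n) → Connected T → 3 ≤ n → ∀ {c} (P : Fin (2 + c) → Fin n) →
  (∀ {i j} → Edge T (P i) (P j) → PathAdj (2 + c) i j) →
  (∀ {i j} → PathAdj (2 + c) i j → Edge T (P i) (P j)) →
  (∀ {x} → InSkel T x → ∃ λ i → P i ≡ x) → FirstSkel T P
first-skel T con 3≤n {c} P adj⁻ adj⁺ covers with skel? T (P zero)
... | yes s = record { i = zero ; skel = s ; one = one ; near = inj₁ refl ; minimal = λ _ → z≤n }
  where
  one : OneSkelNeighbour T (P zero)
  one ey ez sy sz with covers sy | covers sz
  ... | i , refl | j , refl with adj⁻ {zero} {i} ey | adj⁻ {zero} {j} ez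
  ... | inj₁ p | inj₁ q = cong P (toℕ-injective (trans p (≡-sym q)))
... | no ¬s = record
  { i = suc zero
  ; skel = leaf-neighbour T con 3≤n ¬s (adj⁺ {zero} {suc zero} (inj₁ refl))
  ; one = one
  ; near = inj₂ (¬s , adj⁺ {suc zero} {zero} (inj₂ refl))
  ; minimal = λ { {zero} s → ⊥-elim (¬s s) ; {suc j} s → s≤s z≤n } }
  where
  one : OneSkelNeighbour T (P (suc zero))
  one ey ez sy sz with covers sy | covers sz
  ... | zero , refl | _ = ⊥-elim (¬s sy)
  ... | _ | zero , refl = ⊥-elim (¬s sz)
  ... | suc i , refl | suc j , refl with adj⁻ {suc zero} {suc i} ey | adj⁻ {suc zero} {suc j} ez
  ... | inj₁ p | inj₁ q = cong P (toℕ-injective (trans p (≡-sym q)))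

-- Exchanging leaves at one vertex

Automorphism : ∀ {n} → Graph n → Permutation′ n → Set
Automorphism T ρ = ∀ x y → adj T x y ≡ adj T (ρ ⟨$⟩ʳ x) (ρ ⟨$⟩ʳ y)

-- Equal neighbourhoods allow one argument of `adj` to be moved at a time; symmetry of `adj` handles
-- the other.
transpose-twins : ∀ {n} (T : Graph n) {p q} → (∀ z → adj T p z ≡ adj T q z) →
                  Automorphism T (transpose p q)
transpose-twins T {p} {q} twin x y = begin
  adj T x y             ≡⟨ sym T x y ⟩
  adj T y x             ≡⟨ half y x ⟩
  adj T (ρ y) x         ≡⟨ sym T (ρ y) x ⟩
  adj T x (ρ y)         ≡⟨ half x (ρ y) ⟩
  adj T (ρ x) (ρ y)     ∎
  where
  open ≡-Reasoning
  ρ = transpose p q ⟨$⟩ʳ_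
  half : ∀ x z → adj T x z ≡ adj T (ρ x) z
  half x z = case x ≟ p of λ
    { (yes refl) → trans (twin z) (cong (λ v → adj T v z) (≡-sym (transpose-eqˡ p q)))
    ; (no x≢p) → case x ≟ q of λ
      { (yes refl) → trans (≡-sym (twin z)) (cong (λ v → adj T v z) (≡-sym (transpose-eqʳ p q)))
      ; (no x≢q) → cong (λ v → adj T v z) (≡-sym (transpose-other x≢p x≢q)) } }

tip : ∀ {n} → Fin n → Fin n → Bool → Fin n
tip a ℓ b = if b then a else ℓ

tip≢ℓ′ : ∀ {n} {T : Graph n} (E : Ends T) b → tip (Ends.a E) (Ends.ℓ E) b ≢ Ends.ℓ′ E
tip≢ℓ′ {T = T} E true  eq = Ends.leafʳ E (subst (InSkel T) eq (Ends.skelˡ E))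
tip≢ℓ′ E false eq = Ends.ℓ≢ℓ′ E eq

-- Normalises the position `s` to `a` or to the fixed leaf `ℓ`. The last three fields make it
-- possible to follow a move at one end by a move at the other without undoing the first.
record Move {n} (T : Graph n) (a ℓ s : Fin n) : Set where
  field
    b        : Bool
    ρ        : Permutation′ n
    auto     : Automorphism T ρ
    moves    : ρ ⟨$⟩ʳ s ≡ tip a ℓ b
    fixes    : ∀ {x} → x ≢ s → x ≢ ℓ → ρ ⟨$⟩ʳ x ≡ x
    skelFix  : ∀ {x} → InSkel T x → ρ ⟨$⟩ʳ x ≡ x
    leafKeep : ∀ {x} → ¬ InSkel T x → ¬ InSkel T (ρ ⟨$⟩ʳ x)

-- Two leaves at `a` have the same neighbourhood, so exchanging them is an automorphism; if `s` is
-- `a` itself the identity suffices.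
move : ∀ {n} (T : Graph n) {a ℓ s} → Edge T a ℓ → ¬ InSkel T ℓ → Near T a s → Move T a ℓ s
move T eℓ ¬ℓ (inj₁ refl) = record
  { b = true ; ρ = Perm.id ; auto = λ _ _ → refl ; moves = refl
  ; fixes = λ _ _ → refl ; skelFix = λ _ → refl ; leafKeep = id }
move T {a} {ℓ} {s} eℓ ¬ℓ (inj₂ (¬s , es)) = record
  { b = false ; ρ = transpose s ℓ
  ; auto = transpose-twins T λ z → bool-ext
      (λ e → subst (Edge T ℓ) (leaf-unique T ¬s (edge-sym T es) e) (edge-sym T eℓ))
      (λ e → subst (Edge T s) (leaf-unique T ¬ℓ (edge-sym T eℓ) e) (edge-sym T es))
  ; moves = transpose-eqˡ s ℓ
  ; fixes = transpose-other
  ; skelFix = λ sx → transpose-other (λ { refl → ¬s sx }) (λ { refl → ¬ℓ sx })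
  ; leafKeep = leafKeep }
  where
  leafKeep : ∀ {x} → ¬ InSkel T x → ¬ InSkel T (transpose s ℓ ⟨$⟩ʳ x)
  leafKeep {x} ¬x = case x ≟ s of λ
    { (yes refl) → subst (¬_ ∘ InSkel T) (≡-sym (transpose-eqˡ s ℓ)) ¬ℓ
    ; (no x≢s) → case x ≟ ℓ of λ
      { (yes refl) → subst (¬_ ∘ InSkel T) (≡-sym (transpose-eqʳ s ℓ)) ¬s
      ; (no x≢ℓ) → subst (¬_ ∘ InSkel T) (≡-sym (transpose-other x≢s x≢ℓ)) ¬x } }

-- Pairs of common cards

-- The booleans say whether the neighbours of u are sent to the skeleton ends a, a′ of T
-- or to the fixed leaves ℓ, ℓ′ hanging there; other leaves are first exchanged with ℓ, ℓ′.
record Fit {n} (U T : Graph (suc n)) (E : Ends T) (b b′ : Bool) (u t : Fin (suc n)) : Set where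
  open Ends E
  field
    σ       : Permutation′ (suc n)
    card    : CardIso U T u t σ
    root⁻   : ∀ {x} → Edge U u x → σ ⟨$⟩ʳ x ≡ tip a ℓ b ⊎ σ ⟨$⟩ʳ x ≡ tip a′ ℓ′ b′
    rootˡ   : ∀ {x} → σ ⟨$⟩ʳ x ≡ tip a ℓ b → Edge U u x
    rootʳ   : ∀ {x} → σ ⟨$⟩ʳ x ≡ tip a′ ℓ′ b′ → Edge U u x
    pendant : Pendant T t
    t≢tipˡ  : t ≢ tip a ℓ b
    t≢tipʳ  : t ≢ tip a′ ℓ′ b′

module Pair {n k} (U T : Graph (suc n)) (conU : Connected U) (conT : Connected T) (3≤n : 3 ≤ suc n)
            (f : Fin (3 + k) → Fin (suc n)) (cyc : IsCycle U k f)
            (E : Ends T) (acyclic : NoCycle T)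
            {u t : Fin (suc n)} (τ : Permutation′ (suc n)) (card : CardIso U T u t τ) where

  open Ends E

  σ : Fin (suc n) → Fin (suc n)
  σ = τ ⟨$⟩ʳ_

  σu≡t : σ u ≡ t
  σu≡t = proj₁ card

  edge⁺ : ∀ {x y} → x ≢ u → y ≢ u → Edge U x y → Edge T (σ x) (σ y)
  edge⁺ x≢u y≢u e = trans (≡-sym (proj₂ card _ _ x≢u y≢u)) e

  edge⁻ : ∀ {x y} → x ≢ u → y ≢ u → Edge T (σ x) (σ y) → Edge U x y
  edge⁻ x≢u y≢u e = trans (proj₂ card _ _ x≢u y≢u) e

  σ≢t : ∀ {x} → x ≢ u → σ x ≢ t
  σ≢t x≢u eq = x≢u (perm-injective τ (trans eq (≡-sym σu≡t)))

  pull : ∀ y → y ≢ t → ∃ λ x → x ≢ u × σ x ≡ y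
  pull y y≢t = τ ⟨$⟩ˡ y , (λ { eq → y≢t (trans (≡-sym (inverseʳ τ)) (trans (cong σ eq) σu≡t)) }) , inverseʳ τ

  -- Otherwise the whole cycle of `U` would survive in `U - u` and be carried into the acyclic `T`.
  u-skel : InSkel U u
  u-skel = decidable-stable (skel? U u) λ ¬su →
    let off : ∀ i → f i ≢ u
        off i eq = ¬su (subst (InSkel U) eq (proj₁ (proj₂ (proj₁ cyc)) i))
    in acyclic k (σ ∘ f) (λ eq → proj₁ (proj₁ cyc) (perm-injective τ eq))
         (λ i j c → edge⁺ (off i) (off j) (proj₂ (proj₂ cyc i j) c))

  abstract
    opened : Opened U k u
    opened = open-cycle U f cyc u-skel

  open Opened opened

  P : Fin (2 + k) → Fin (suc n)
  P = σ ∘ path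

  P-injective : Injective _≡_ _≡_ P
  P-injective eq = injective (perm-injective τ eq)

  P-adj⁻ : ∀ {i j} → Edge T (P i) (P j) → PathAdj (2 + k) i j
  P-adj⁻ {i} {j} e = adj⁻ (edge⁻ (avoids i) (avoids j) e)

  P-adj⁺ : ∀ {i j} → PathAdj (2 + k) i j → Edge T (P i) (P j)
  P-adj⁺ {i} {j} p = edge⁺ (avoids i) (avoids j) (adj⁺ p)

  -- Every edge of `T - t` has an end on `P`, because every edge of `U - u` meets the opened cycle.
  -- Since `P` is connected and avoids `t`, the edge inside `Side` forces all of `P` into `Side`,
  -- and then the other edge as well.
  not-separating : ¬ Separates T t
  not-separating sep = outside (all-inside (endpoint edge^q q≢t q′≢t))
    where
    open Separates sep
    endpoint : ∀ {p q} → Edge T p q → p ≢ t → q ≢ t → ∃ λ i → P i ≡ p ⊎ P i ≡ q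
    endpoint {p} {q} e p≢t q≢t with pull p p≢t | pull q q≢t
    ... | x , x≢u , refl | y , y≢u , refl with skel? U x
    ... | yes sx = let i , eq = covers x sx x≢u in i , inj₁ (cong σ eq)
    ... | no ¬sx = let i , eq = covers y (leaf-neighbour U conU 3≤n ¬sx (edge⁻ x≢u y≢u e)) y≢u
                   in i , inj₂ (cong σ eq)
    step : ∀ {i j} → Side (P i) → PathAdj (2 + k) i j → Side (P j)
    step {i} {j} s p = closed s (P-adj⁺ p) (σ≢t (avoids j))
    to-zero : ∀ i → Side (P i) → Side (P zero)
    to-zero = <-weakInduction _ id λ i ih s → ih (step s (inj₂ (cong suc (≡-sym (toℕ-inject₁ i)))))
    from-zero : Side (P zero) → ∀ i → Side (P i)
    from-zero s = <-weakInduction _ s λ i s′ → step s′ (inj₁ (cong suc (≡-sym (toℕ-inject₁ i))))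
    on-path : ∀ i → Side (P i)
    on-path with endpoint edgeᵖ p≢t p′≢t
    ... | i , inj₁ refl = from-zero (to-zero i inside)
    ... | i , inj₂ refl = from-zero (to-zero i (closed inside edgeᵖ p′≢t))
    all-inside : (∃ λ i → P i ≡ q ⊎ P i ≡ q′) → Side q
    all-inside (i , inj₁ refl) = on-path i
    all-inside (i , inj₂ refl) = closed (on-path i) (edge-sym T edge^q) q≢t

  module Leaf (¬st : ¬ InSkel T t) (t≢ℓ : t ≢ ℓ) (t≢ℓ′ : t ≢ ℓ′) where

    skel≢t : ∀ {x} → InSkel T x → x ≢ t
    skel≢t sx refl = ¬st sx

    tip-like : ∀ {y} → InSkel T y ⊎ y ≡ ℓ ⊎ y ≡ ℓ′ → y ≢ t
    tip-like (inj₁ s) = skel≢t s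
    tip-like (inj₂ (inj₁ refl)) = t≢ℓ ∘ ≡-sym
    tip-like (inj₂ (inj₂ refl)) = t≢ℓ′ ∘ ≡-sym

    pendant : Pendant T t
    pendant with has-neighbour T conT (skel≢t skelˡ ∘ ≡-sym)
    ... | s , e with core (leaf-neighbour T conT 3≤n ¬st e)
    ... | y , z , y≢z , (ey , ty) , (ez , tz) = record
      { edge = e ; unique = λ e′ → leaf-unique T ¬st e′ e ; y≢z = y≢z
      ; edgeʸ = ey ; edgeᶻ = ez ; y≢t = tip-like ty ; z≢t = tip-like tz }

    open Pendant pendant using (skel-off; unique; s) renaming (edge to edgeᵗ)

    -- A leaf at `u` would be isolated in `U - u`, but `T - t` has no isolated vertex. Thus `u` has
    -- degree two.
    leafless : ∀ {x} → Edge U u x → InSkel U x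
    leafless {x} e = decidable-stable (skel? U x) λ ¬sx → ¬sx (extra (has-neighbour T conT (σ≢t x≢u)))
      where
      x≢u : x ≢ u
      x≢u = edge-≢ U e ∘ ≡-sym
      second : ∀ {w} → Edge T (σ x) w → w ≢ t → InSkel U x
      second {w} ew w≢t with pull w w≢t
      ... | w₀ , w₀≢u , refl = skel⁺ U w₀≢u (edge⁻ x≢u w₀≢u ew) (edge-sym U e)
      extra : ∃ (Edge T (σ x)) → InSkel U x
      extra (w , ew) with w ≟ t
      ... | no w≢t = second ew w≢t
      -- Here `σ x` is the neighbour of `t`, which has further neighbours.
      ... | yes refl with skel-off (subst (InSkel T) (leaf-unique T ¬st edgeᵗ (edge-sym T ew))
                                         (leaf-neighbour T conT 3≤n ¬st edgeᵗ))
      ... | p , _ , _ , (ep , p≢t) , _ = second ep p≢t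

    root-ends : ∀ {x} → Edge U u x → x ≡ path zero ⊎ x ≡ path (fromℕ (suc k))
    root-ends {x} e with covers x (leafless e) (edge-≢ U e ∘ ≡-sym)
    ... | i , refl with root⁻ e
    ... | inj₁ refl = inj₁ refl
    ... | inj₂ refl = inj₂ refl

    -- A skeleton vertex of `T` has two neighbours other than `t`, so its preimage has degree at
    -- least two already in `U - u` and lies on the opened cycle.
    P-covers : ∀ {x} → InSkel T x → ∃ λ i → P i ≡ x
    P-covers {x} sx with pull x (skel≢t sx) | skel-off sx
    ... | x₀ , x₀≢u , refl | p , q , p≢q , (ep , p≢t) , (eq , q≢t) with pull p p≢t | pull q q≢t
    ... | p₀ , p₀≢u , refl | q₀ , q₀≢u , refl =
      let i , eqᵢ = covers x₀ (skel⁺ U (p≢q ∘ cong σ) (edge⁻ x₀≢u p₀≢u ep) (edge⁻ x₀≢u q₀≢u eq)) x₀≢u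
      in i , cong σ eqᵢ

    abstract
      front : FirstSkel T P
      front = first-skel T conT 3≤n P (λ {i} {j} → P-adj⁻ {i} {j}) (λ {i} {j} → P-adj⁺ {i} {j}) P-covers

      back : FirstSkel T (P ∘ opposite)
      back = first-skel T conT 3≤n (P ∘ opposite)
        (λ {i} {j} e → subst₂ (PathAdj (2 + k)) (opposite-involutive i) (opposite-involutive j)
                         (pathAdj-opposite (P-adj⁻ {opposite i} {opposite j} e)))
        (λ {i} {j} p → P-adj⁺ {opposite i} {opposite j} (pathAdj-opposite p))
        (λ sx → let i , eq = P-covers sx in opposite i , trans (cong P (opposite-involutive i)) eq)

    module F = FirstSkel front
    module B = FirstSkel back

    rF = P F.i
    rB = P (opposite B.i)

    -- On `P`, the position `F.i` is a lower bound and `opposite B.i` an upper bound for skeleton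
    -- vertices; when the two agree the skeleton is a single vertex.
    one-end : rF ≡ rB → ∀ {x} → InSkel T x → rF ≡ x
    one-end eq {x} sx with P-covers sx
    ... | j , refl = cong P (toℕ-injective (≤-antisym (F.minimal sx)
      (opposite-≤⁻ (subst (λ m → toℕ m ≤ toℕ (opposite j))
        (trans (≡-sym (opposite-involutive B.i)) (cong opposite (≡-sym (P-injective eq))))
        (B.minimal (subst (InSkel T) (cong P (≡-sym (opposite-involutive j))) sx))))))

    s₁ = P zero
    s₂ = P (fromℕ (suc k))

    s₁≢s₂ : s₁ ≢ s₂
    s₁≢s₂ eq = case P-injective eq of λ ()

    root⁻₁₂ : ∀ {x} → Edge U u x → σ x ≡ s₁ ⊎ σ x ≡ s₂
    root⁻₁₂ e with root-ends e
    ... | inj₁ refl = inj₁ refl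
    ... | inj₂ refl = inj₂ refl

    root₁ : ∀ {x} → σ x ≡ s₁ → Edge U u x
    root₁ eq with perm-injective τ eq
    ... | refl = first

    root₂ : ∀ {x} → σ x ≡ s₂ → Edge U u x
    root₂ eq with perm-injective τ eq
    ... | refl = last

    -- Composing the card isomorphism with a move at `a` and then one at `a′` normalises both
    -- images. The composite fixes `t`, which differs from `p`, `q`, `ℓ` and `ℓ′`.
    fit-from : ∀ {p q} → Near T a p → Near T a′ q → p ≢ q → p ≢ t → q ≢ t →
      (∀ {x} → Edge U u x → σ x ≡ p ⊎ σ x ≡ q) →
      (∀ {x} → σ x ≡ p → Edge U u x) → (∀ {x} → σ x ≡ q → Edge U u x) →
      ∃₂ λ b b′ → Fit U T E b b′ u t
    fit-from {p} {q} np nq p≢q p≢t q≢t r⁻ rp rq = M.b , M′.b , record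
      { σ = τ ∘ₚ π
      ; card = trans (cong (π ⟨$⟩ʳ_) σu≡t) πt≡t
             , λ x y x≢u y≢u → trans (proj₂ card x y x≢u y≢u)
                 (trans (M.auto _ _) (M′.auto _ _))
      ; root⁻ = λ e → [ (λ eq → inj₁ (trans (cong (π ⟨$⟩ʳ_) eq) πp)) , (λ eq → inj₂ (trans (cong (π ⟨$⟩ʳ_) eq) M′.moves)) ]′ (r⁻ e)
      ; rootˡ = λ eq → rp (perm-injective π (trans eq (≡-sym πp)))
      ; rootʳ = λ eq → rq (perm-injective π (trans eq (≡-sym M′.moves)))
      ; pendant = pendant
      ; t≢tipˡ = λ eq → p≢t (perm-injective π (trans πp (trans (≡-sym eq) (≡-sym πt≡t))))
      ; t≢tipʳ = λ eq → q≢t (perm-injective π (trans M′.moves (trans (≡-sym eq) (≡-sym πt≡t))))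
      }
      where
      M₁ : Move T a ℓ p
      M₁ = move T edgeˡ leafˡ np
      module M = Move M₁
      -- When `a` and `a′` coincide the first move may shift `q`, but its image is still `a′` or a
      -- leaf there.
      near′ : Near T a′ q → Near T a′ (M.ρ ⟨$⟩ʳ q)
      near′ (inj₁ refl) = inj₁ (M.skelFix skelʳ)
      near′ (inj₂ (¬q , e)) = inj₂ (M.leafKeep ¬q ,
        subst (λ v → Edge T v (M.ρ ⟨$⟩ʳ q)) (M.skelFix skelʳ) (trans (≡-sym (M.auto a′ q)) e))
      M₂ : Move T a′ ℓ′ (M.ρ ⟨$⟩ʳ q)
      M₂ = move T edgeʳ leafʳ (near′ nq)
      module M′ = Move M₂
      π = M.ρ ∘ₚ M′.ρ
      πp : π ⟨$⟩ʳ p ≡ tip a ℓ M.b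
      πp = trans (cong (M′.ρ ⟨$⟩ʳ_) M.moves)
        -- The second move leaves the image of `p` in place, as that differs from the image of `q`
        -- and from `ℓ′`.
        (M′.fixes (λ eq → p≢q (perm-injective M.ρ (trans M.moves eq))) (tip≢ℓ′ E M.b))
      πt≡t : π ⟨$⟩ʳ t ≡ t
      πt≡t = trans (cong (M′.ρ ⟨$⟩ʳ_) ρt≡t)
        (M′.fixes (λ eq → q≢t (perm-injective M.ρ (trans (≡-sym eq) (≡-sym ρt≡t)))) t≢ℓ′)
        where
        ρt≡t = M.fixes (p≢t ∘ ≡-sym) t≢ℓ

    near-back : Near T rB s₂
    near-back = B.near

    s₁≢t : s₁ ≢ t
    s₁≢t = σ≢t (avoids zero)

    s₂≢t : s₂ ≢ t
    s₂≢t = σ≢t (avoids (fromℕ (suc k)))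

    aligned : rF ≡ a → rB ≡ a′ → ∃₂ λ b b′ → Fit U T E b b′ u t
    aligned p q = fit-from (subst (λ r → Near T r s₁) p F.near) (subst (λ r → Near T r s₂) q near-back)
      s₁≢s₂ s₁≢t s₂≢t root⁻₁₂ root₁ root₂

    crossed : rF ≡ a′ → rB ≡ a → ∃₂ λ b b′ → Fit U T E b b′ u t
    crossed p q = fit-from (subst (λ r → Near T r s₂) q near-back) (subst (λ r → Near T r s₁) p F.near)
      (s₁≢s₂ ∘ ≡-sym) s₂≢t s₁≢t ([ inj₂ , inj₁ ]′ ∘ root⁻₁₂) root₂ root₁

    fit : ∃₂ λ b b′ → Fit U T E b b′ u t
    fit with isEnd F.skel F.one | isEnd B.skel B.one
    ... | inj₁ p | inj₂ q = aligned p q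
    ... | inj₂ p | inj₁ q = crossed p q
    -- If both ends of `P` lead to `a`, then the skeleton is one vertex and `a` equals `a′`.
    ... | inj₁ p | inj₁ q = aligned p (trans q (trans (≡-sym p) (one-end (trans p (≡-sym q)) skelʳ)))
    ... | inj₂ p | inj₂ q = aligned (one-end (trans p (≡-sym q)) skelˡ) q

  classify : (t ≡ a ⊎ t ≡ a′ ⊎ t ≡ ℓ ⊎ t ≡ ℓ′) ⊎ (∃₂ λ b b′ → Fit U T E b b′ u t)
  classify with skel? T t
  ... | yes st with interior-separates st
  ... | inj₁ p = inj₁ (inj₁ p)
  ... | inj₂ (inj₁ p) = inj₁ (inj₂ (inj₁ p))
  ... | inj₂ (inj₂ sep) = ⊥-elim (not-separating sep)
  classify | no ¬st with t ≟ ℓ | t ≟ ℓ′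
  ... | yes p | _     = inj₁ (inj₂ (inj₂ (inj₁ p)))
  ... | no _  | yes p = inj₁ (inj₂ (inj₂ (inj₂ p)))
  ... | no p  | no q  = inj₂ (Leaf.fit ¬st p q)

-- Adding a vertex of degree two to a caterpillar

-- The new vertex is `zero`, so deleting it gives back `T` with its labels shifted by `suc`.
glue : ∀ {n} → Graph n → Fin n → Fin n → Graph (suc n)
adj   (glue T p q) zero    zero    = false
adj   (glue T p q) zero    (suc y) = does (y ≟ p) ∨ does (y ≟ q)
adj   (glue T p q) (suc x) zero    = does (x ≟ p) ∨ does (x ≟ q)
adj   (glue T p q) (suc x) (suc y) = adj T x y
sym   (glue T p q) zero    zero    = refl
sym   (glue T p q) zero    (suc y) = refl
sym   (glue T p q) (suc x) zero    = refl
sym   (glue T p q) (suc x) (suc y) = sym T x y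
irref (glue T p q) zero    = refl
irref (glue T p q) (suc x) = irref T x

module Transfer {n} (G : Graph (suc n)) (H : Graph n) (Λ : Permutation′ (suc n))
                (iso : ∀ x y → adj H x y ≡ adj G (Λ ⟨$⟩ʳ suc x) (Λ ⟨$⟩ʳ suc y))
                (pendant : Pendant G (Λ ⟨$⟩ʳ zero)) where

  open Pendant pendant

  lift-skel : ∀ {x} → InSkel H x → InSkel G (Λ ⟨$⟩ʳ suc x)
  lift-skel sx with skel⁻ H sx
  ... | p , q , p≢q , ep , eq = skel⁺ G (p≢q ∘ Fin-suc-injective ∘ perm-injective Λ)
          (trans (≡-sym (iso _ _)) ep) (trans (≡-sym (iso _ _)) eq)

  lower : ∀ z → z ≢ Λ ⟨$⟩ʳ zero → ∃ λ x → Λ ⟨$⟩ʳ suc x ≡ z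
  lower z z≢ with Λ ⟨$⟩ˡ z in eq
  ... | zero  = ⊥-elim (z≢ (trans (≡-sym (inverseʳ Λ)) (cong (Λ ⟨$⟩ʳ_) eq)))
  ... | suc x = x , trans (cong (Λ ⟨$⟩ʳ_) (≡-sym eq)) (inverseʳ Λ)

  -- The pendant vertex is outside the skeleton, and each skeleton vertex has two neighbours apart
  -- from it; hence `G` and `H` have corresponding skeletons.
  lower-skel : ∀ z → InSkel G z → ∃ λ x → InSkel H x × Λ ⟨$⟩ʳ suc x ≡ z
  lower-skel z sz with lower z (λ { refl → notSkel sz }) | skel-off sz
  ... | x , refl | p , q , p≢q , (ep , p≢t) , (eq , q≢t) with lower p p≢t | lower q q≢t
  ... | _ , refl | _ , refl = x , skel⁺ H (p≢q ∘ cong (λ i → Λ ⟨$⟩ʳ suc i))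
          (trans (iso _ _) ep) (trans (iso _ _) eq) , refl

  connected : Connected H → Connected G
  connected con x y = star⇒walk G (reverse (edge-sym G) (reach x) ◅◅ reach y)
    where
    s₀ = lower s (edge-≢ G edge ∘ ≡-sym)
    reach′ : ∀ x → Star (Edge G) s (Λ ⟨$⟩ʳ suc x)
    reach′ = connected-induction H con (λ x → Star (Edge G) s (Λ ⟨$⟩ʳ suc x))
      (λ r e → r ◅◅ (trans (≡-sym (iso _ _)) e ◅ ε)) (subst (Star (Edge G) s) (≡-sym (proj₂ s₀)) ε)
    reach : ∀ z → Star (Edge G) s z
    reach z with z ≟ Λ ⟨$⟩ʳ zero
    ... | yes refl = edge-sym G edge ◅ ε
    ... | no z≢ with lower z z≢
    ... | x , refl = reach′ x

  cycle : ∀ {k} (f : Fin (3 + k) → Fin n) → IsCycle H k f → IsCycle G k (λ i → Λ ⟨$⟩ʳ suc (f i))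
  cycle f ((inj , skel , surj) , adjs) =
    ( inj ∘ Fin-suc-injective ∘ perm-injective Λ
    , lift-skel ∘ skel
    , λ z sz → let x , sx , eq = lower-skel z sz ; i , eqᵢ = surj x sx
               in i , trans (cong (λ x → Λ ⟨$⟩ʳ suc x) eqᵢ) eq ) ,
    λ i j → (λ e → proj₁ (adjs i j) (trans (iso _ _) e))
          , (λ c → trans (≡-sym (iso _ _)) (proj₂ (adjs i j) c))

module Glue {n} (T : Graph n) (p q : Fin n) where

  Z : Graph (suc n)
  Z = glue T p q

  glue⁻ : ∀ {x} → Edge Z zero (suc x) → x ≡ p ⊎ x ≡ q
  glue⁻ {x} e with x ≟ p | x ≟ q
  ... | yes eq | _      = inj₁ eq
  ... | no _   | yes eq = inj₂ eq

  glueˡ : Edge Z zero (suc p)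
  glueˡ rewrite proj₂ (dec-yes (p ≟ p) refl) = refl

  glueʳ : Edge Z zero (suc q)
  glueʳ rewrite proj₂ (dec-yes (q ≟ q) refl) = Boolₚ.∨-zeroʳ _

  glue⁺ : ∀ {x} → x ≡ p ⊎ x ≡ q → Edge Z zero (suc x)
  glue⁺ (inj₁ refl) = glueˡ
  glue⁺ (inj₂ refl) = glueʳ

  suc-skel : ∀ {x} → InSkel T x → InSkel Z (suc x)
  suc-skel {x} sx with skel⁻ T sx
  ... | _ , _ , y≢z , ey , ez = skel⁺ Z {suc x} (y≢z ∘ Fin-suc-injective) ey ez

  suc-pendant : ∀ {t} → Pendant T t → t ≢ p → t ≢ q → Pendant Z (suc t)
  suc-pendant {t} pendant t≢p t≢q = record
    { edge = edge
    ; unique = λ { {zero} e → ⊥-elim ([ t≢p , t≢q ]′ (glue⁻ e)) ; {suc x} e → cong suc (unique e) }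
    ; y≢z = y≢z ∘ Fin-suc-injective
    ; edgeʸ = edgeʸ ; edgeᶻ = edgeᶻ
    ; y≢t = y≢t ∘ Fin-suc-injective ; z≢t = z≢t ∘ Fin-suc-injective }
    where open Pendant pendant

module Supercard {n} {U T : Graph (suc n)} {E : Ends T} {b b′ u t} (F : Fit U T E b b′ u t) where

  open Ends E
  open Fit F
  open Glue T (tip a ℓ b) (tip a′ ℓ′ b′)

  -- The argument zero stands for the leaf missing from U.
  Λ : Permutation′ (suc (suc n))
  Λ = lift₀ σ ∘ₚ transpose zero (suc t)

  Λ-zero : Λ ⟨$⟩ʳ zero ≡ suc t
  Λ-zero = transpose-eqˡ zero (suc t)

  Λ-root : Λ ⟨$⟩ʳ suc u ≡ zero
  Λ-root = trans (cong (λ x → transpose zero (suc t) ⟨$⟩ʳ suc x) (proj₁ card)) (transpose-eqʳ zero (suc t))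

  Λ-other : ∀ {x} → x ≢ u → Λ ⟨$⟩ʳ suc x ≡ suc (σ ⟨$⟩ʳ x)
  Λ-other {x} x≢u = transpose-other {i = zero} {suc t} {suc (σ ⟨$⟩ʳ x)} (λ ()) (λ eq →
    x≢u (perm-injective σ (trans (Fin-suc-injective eq) (≡-sym (proj₁ card)))))

  root : ∀ x → adj U u x ≡ adj Z zero (suc (σ ⟨$⟩ʳ x))
  root x = bool-ext (glue⁺ ∘ root⁻) ([ rootˡ , rootʳ ]′ ∘ glue⁻)

  -- Away from `u` this is the card isomorphism; at `u` the root fields say that its neighbours go
  -- exactly to the two vertices glued to `zero`.
  Λ-iso : ∀ x y → adj U x y ≡ adj Z (Λ ⟨$⟩ʳ suc x) (Λ ⟨$⟩ʳ suc y)
  Λ-iso x y = case x ≟ u of λ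
    { (yes refl) → case y ≟ u of λ
      { (yes refl) → trans (irref U u) (≡-sym (irref Z (Λ ⟨$⟩ʳ suc u)))
      ; (no y≢u) → trans (root y) (≡-sym (cong₂ (adj Z) Λ-root (Λ-other y≢u))) }
    ; (no x≢u) → case y ≟ u of λ
      { (yes refl) → trans (sym U x u) (trans (root x) (≡-sym (cong₂ (adj Z) (Λ-other x≢u) Λ-root)))
      ; (no y≢u) → trans (proj₂ card x y x≢u y≢u) (≡-sym (cong₂ (adj Z) (Λ-other x≢u) (Λ-other y≢u))) } }

  open Transfer Z U Λ Λ-iso (subst (Pendant Z) (≡-sym Λ-zero) (suc-pendant pendant t≢tipˡ t≢tipʳ)) public
    using (connected; cycle)

-- Comparing skeleton sizes

-- Both skeletons have `c` vertices, while `y` together with the skeleton of `G` gives `c + 1`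
-- vertices in that of `H`.
skel-strict : ∀ {n c} (G H : Graph n) (A B : Fin c → Fin n) → EnumSkel G A → EnumSkel H B →
  (∀ x → InSkel G x → InSkel H x) → ∀ {y} → InSkel H y → ¬ InSkel G y → ⊥
skel-strict {c = c} G H A B (A-inj , A-skel , _) (_ , _ , B-surj) sub {y} sy ¬sy =
  1+n≰n (injective⇒≤ {f = code} code-injective)
  where
  code : Fin (suc c) → Fin c
  code zero    = proj₁ (B-surj y sy)
  code (suc i) = proj₁ (B-surj (A i) (sub _ (A-skel i)))
  decode : Fin (suc c) → Fin _
  decode = y ∷ A
  B-code : ∀ i → B (code i) ≡ decode i
  B-code zero    = proj₂ (B-surj y sy)
  B-code (suc i) = proj₂ (B-surj (A i) (sub _ (A-skel i)))
  decode-injective : ∀ i j → decode i ≡ decode j → i ≡ j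
  decode-injective zero    zero    _  = refl
  decode-injective zero    (suc j) eq = ⊥-elim (¬sy (subst (InSkel G) (≡-sym eq) (A-skel j)))
  decode-injective (suc i) zero    eq = ⊥-elim (¬sy (subst (InSkel G) eq (A-skel i)))
  decode-injective (suc i) (suc j) eq = cong suc (A-inj eq)
  code-injective : Injective _≡_ _≡_ code
  code-injective {i} {j} eq =
    decode-injective i j (trans (≡-sym (B-code i)) (trans (cong B eq) (B-code j)))

-- Both ways of gluing at the second end would give skeletons of different sizes.
second-end-determined : ∀ {n k} {U T : Graph (suc n)} {E : Ends T} (f : Fin (3 + k) → Fin (suc n)) →
  IsCycle U k f → ∀ {b u t u₁ t₁} → Fit U T E b true u t → Fit U T E b false u₁ t₁ → ⊥
second-end-determined {U = U} {T} {E} f cyc {b} F F₁ =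
  -- Both glued graphs have a skeleton cycle of length `3 + k`, inherited from `U`. Gluing at `ℓ′`
  -- makes `ℓ′` a skeleton vertex, while gluing at `a′` leaves it a leaf.
  skel-strict K.Z L.Z _ _
    (proj₁ (Supercard.cycle F f cyc)) (proj₁ (Supercard.cycle F₁ f cyc)) sub {suc ℓ′}
    (skel⁺ (glue T p ℓ′) {suc ℓ′} {zero} {suc a′} (λ ()) L.glueʳ (edge-sym T edgeʳ)) notSkel
  where
  open Ends E
  p = tip a ℓ b
  module K = Glue T p a′
  module L = Glue T p ℓ′
  -- Only the edge from `a′` to the new vertex may be lost, and `a′` has degree two already in `T`.
  keep : ∀ {x y} → Edge K.Z (suc x) y → Edge L.Z (suc x) y ⊎ x ≡ a′
  keep {y = suc y} e = inj₁ e
  keep {x} {zero} e with K.glue⁻ {x} e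
  ... | inj₁ refl = inj₁ L.glueˡ
  ... | inj₂ eq = inj₂ eq
  sub : ∀ x → InSkel K.Z x → InSkel L.Z x
  sub zero    _ = skel⁺ L.Z {zero} (tip≢ℓ′ E b ∘ Fin-suc-injective) L.glueˡ L.glueʳ
  sub (suc x) s with skel⁻ K.Z {suc x} s
  ... | y , z , y≢z , ey , ez with keep {x} {y} ey | keep {x} {z} ez
  ... | inj₂ refl | _ = L.suc-skel skelʳ
  ... | _ | inj₂ refl = L.suc-skel skelʳ
  ... | inj₁ e | inj₁ e′ = skel⁺ L.Z {suc x} y≢z e e′
  only : ∀ {y} → Edge K.Z (suc ℓ′) y → y ≡ suc a′
  only {zero} e with K.glue⁻ {ℓ′} e
  ... | inj₁ eq = ⊥-elim (tip≢ℓ′ E b (≡-sym eq))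
  ... | inj₂ eq = ⊥-elim (leafʳ (subst (InSkel T) (≡-sym eq) skelʳ))
  only {suc y} e = cong suc (leaf-unique T leafʳ e (edge-sym T edgeʳ))
  notSkel : ¬ InSkel K.Z (suc ℓ′)
  notSkel s with skel⁻ K.Z {suc ℓ′} s
  ... | y , z , y≢z , ey , ez = y≢z (trans (only {y} ey) (≡-sym (only {z} ez)))

-- Saturating sets

length-filter-∘ : ∀ {A B : Set} {P : A → Set} (P? : ∀ x → Dec (P x)) (h : B → A) {n} (g : Fin n → B) →
  length (filter (P? ∘ h) (tabulate g)) ≡ length (filter P? (tabulate (h ∘ g)))
length-filter-∘ P? h {zero}  g = refl
length-filter-∘ P? h {suc n} g with does (P? (h (g zero)))
... | true  = cong suc (length-filter-∘ P? h (g ∘ suc))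
... | false = length-filter-∘ P? h (g ∘ suc)

length-filter-∷ : ∀ {A : Set} {P : A → Set} (P? : ∀ x → Dec (P x)) x xs →
  length (filter P? xs) ≤ length (filter P? (x List.∷ xs))
length-filter-∷ P? x xs with does (P? x)
... | true  = n≤1+n _
... | false = ≤-refl

module Saturating {N} (G : Graph N) (w v : Fin N) where

  -- A candidate for `MaxSaturating`, before maximality is imposed.
  record Matching (m : ℕ) (X : Fin m → Permutation′ N) : Set where
    field
      inB      : ∀ i → InBvw G w v (X i)
      hasId    : ∃ λ i → ∀ x → X i ⟨$⟩ʳ x ≡ x
      distinct : ∀ i j → i ≢ j → Compatible G w v (X i) (X j)

  count : ∀ {m} → (Fin m → Permutation′ N) → ℕ
  count {m} X = countXU G w v m X

  count≤ : ∀ {m} (X : Fin m → Permutation′ N) → count X ≤ m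
  count≤ {m} X = ≤-trans (length-filter (λ i → inBU? G w v (X i)) (allFin m))
                         (≤-reflexive (length-tabulate {n = m} id))

  count-∷ : ∀ {m} σ (X : Fin m → Permutation′ N) → count X ≤ count (σ ∷ X)
  count-∷ σ X = ≤-trans
    (≤-reflexive (length-filter-∘ (λ i → inBU? G w v ((σ ∷ X) i)) suc id))
    (length-filter-∷ (λ i → inBU? G w v ((σ ∷ X) i)) zero (tabulate suc))

  count-all : ∀ {m} (X : Fin m → Permutation′ N) → (∀ i → InBU G w v (X i)) → count X ≡ m
  count-all {m} X all = trans
    (cong length (filter-all (λ i → inBU? G w v (X i)) (tabulate⁺ {f = id} all)))
    (length-tabulate {n = m} id)

  -- Compatible permutations send `w` to different vertices.
  size≤ : ∀ {m} (X : Fin m → Permutation′ N) → (∀ i j → i ≢ j → Compatible G w v (X i) (X j)) → m ≤ N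
  size≤ {m} X distinct = injective⇒≤ {f = λ i → X i ⟨$⟩ʳ w} λ {i} {j} eq →
    decidable-stable (i ≟ j) λ i≢j → proj₂ (distinct i j i≢j) eq

  add : ∀ {m X} σ → Matching m X → InBvw G w v σ → (∀ i → Compatible G w v σ (X i)) →
        Matching (suc m) (σ ∷ X)
  add σ M inBσ com = record
    { inB = λ { zero → inBσ ; (suc i) → inB i }
    ; hasId = let i , eq = hasId in suc i , eq
    ; distinct = λ { zero zero ne → ⊥-elim (ne refl)
                   ; zero (suc j) _ → com j
                   ; (suc i) zero _ → let p , q = com i in p ∘ ≡-sym , q ∘ ≡-sym
                   ; (suc i) (suc j) ne → distinct i j (ne ∘ cong suc) } }
    where open Matching M

  -- Greedy extension to a maximum saturating set, never decreasing the count. Maximality is not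
  -- decided, so existence is stated under double negation; the fuel suffices because no family has
  -- more than `N` members.
  saturate : ∀ fuel {m} (X : Fin m → Permutation′ N) → Matching m X → N ≤ fuel + m →
    ¬ (∀ {m′} (X′ : Fin m′ → Permutation′ N) → MaxSaturating G w v m′ X′ → ¬ (count X ≤ count X′))
  saturate fuel {m} X M bound none = none X (record
    { inB = inB ; hasId = hasId ; distinct = distinct
    ; maximal = λ σ inBσ _ com → grow fuel bound σ (add σ M inBσ com) }) ≤-refl
    where
    open Matching M
    grow : ∀ fuel → N ≤ fuel + m → ∀ σ → Matching (suc m) (σ ∷ X) → ⊥
    grow zero bound σ M′ = 1+n≰n (≤-trans (size≤ (σ ∷ X) (Matching.distinct M′)) bound)
    grow (suc fuel) bound σ M′ = saturate fuel (σ ∷ X) M′ (≤-trans bound (≤-reflexive (≡-sym (+-suc fuel m))))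
      λ X′ sat le → none X′ sat (≤-trans (count-∷ σ X) le)

  -- A count is either the maximum or exceeded by another one. Counts are at most `N`, so the ascent
  -- stops; existence is again doubly negated.
  chi-above : ∀ fuel {m} (X : Fin m → Permutation′ N) → MaxSaturating G w v m X → N ≤ fuel + count X →
    ¬ (∀ c → IsChi G w v c → ¬ (count X ≤ c))
  chi-above fuel {m} X sat bound none = none (count X)
    ((m , X , sat , refl) , λ m′ X′ sat′ → decidable-stable (_ ≤? _) λ ≰ → larger fuel bound X′ sat′ (≰⇒> ≰)) ≤-refl
    where
    larger : ∀ fuel → N ≤ fuel + count X → ∀ {m′} (X′ : Fin m′ → Permutation′ N) → MaxSaturating G w v m′ X′ → count X < count X′ → ⊥
    larger zero bound X′ sat′ lt = 1+n≰n (≤-trans lt (≤-trans (count≤ X′)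
      (≤-trans (size≤ X′ (MaxSaturating.distinct sat′)) bound)))
    larger (suc fuel) bound X′ sat′ lt = chi-above fuel X′ sat′
      (≤-trans bound (≤-trans (≤-reflexive (≡-sym (+-suc fuel _))) (+-monoʳ-≤ fuel lt)))
      λ c chi le → none c chi (≤-trans (<⇒≤ lt) le)

  -- All members lie in `B_U`, so the family counts fully and extending it cannot lower the count.
  -- The double negations disappear because `m ≤ c` is decidable.
  matching-bound : ∀ {c m} (X : Fin m → Permutation′ N) → Matching m X → (∀ i → InBU G w v (X i)) →
    (∀ c′ → IsChi G w v c′ → c′ ≤ c) → m ≤ c
  matching-bound {c} {m} X M all bound = decidable-stable (m ≤? c) λ m≰c →
    saturate N X M (m≤m+n N m) λ X′ sat le →
      chi-above N X′ sat (m≤m+n N _) λ c′ chi le′ →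
        m≰c (≤-trans (≤-trans (≤-reflexive (≡-sym (count-all X all))) (≤-trans le le′)) (bound c′ chi))

-- Conjugating by the first isomorphism turns it into the identity, at the price of
-- choosing its image t₀ as the leaf w of the supercard.
family-bound : ∀ {n r c} (U T : Graph (suc n)) (Z : Graph (suc (suc n))) →
  (∀ x y → adj T x y ≡ adj Z (suc x) (suc y)) →
  (Λ : Fin r → Permutation′ (suc (suc n))) (u t : Fin r → Fin (suc n)) →
  Injective _≡_ _≡_ u → Injective _≡_ _≡_ t →
  (∀ i → Λ i ⟨$⟩ʳ zero ≡ suc (t i)) → (∀ i → Λ i ⟨$⟩ʳ suc (u i) ≡ zero) →
  (∀ i x y → adj U x y ≡ adj Z (Λ i ⟨$⟩ʳ suc x) (Λ i ⟨$⟩ʳ suc y)) →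
  (∀ w v → SupercardVia U T Z w v → ∀ c′ → IsChi Z w v c′ → c′ ≤ c) → r ≤ c
family-bound {r = zero} _ _ _ _ _ _ _ _ _ _ _ _ _ = z≤n
family-bound {n} {suc r} U T Z T≡Z-0 Λ u t u-inj t-inj Λ-zero Λ-root Λ-iso bound =
  matching-bound X matching inBU (bound w zero supercard)
  where
  Λ₀ = Λ zero
  w = Λ₀ ⟨$⟩ʳ zero
  open Saturating Z w zero
  X : Fin (suc r) → Permutation′ (suc (suc n))
  X i = flip Λ₀ ∘ₚ Λ i
  lower : ∀ x → x ≢ w → ∃ λ y → Λ₀ ⟨$⟩ˡ x ≡ suc y
  lower x x≢w with Λ₀ ⟨$⟩ˡ x in eq
  ... | zero  = ⊥-elim (x≢w (trans (≡-sym (inverseʳ Λ₀)) (cong (Λ₀ ⟨$⟩ʳ_) eq)))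
  ... | suc y = y , refl
  iso : ∀ i x y → x ≢ w → y ≢ w → adj Z x y ≡ adj Z (X i ⟨$⟩ʳ x) (X i ⟨$⟩ʳ y)
  iso i x y x≢w y≢w with lower x x≢w | lower y y≢w
  ... | x′ , eqˣ | y′ , eqʸ = begin
    adj Z x y                                             ≡⟨ cong₂ (adj Z) (back eqˣ) (back eqʸ) ⟩
    adj Z (Λ₀ ⟨$⟩ʳ suc x′) (Λ₀ ⟨$⟩ʳ suc y′)               ≡⟨ ≡-sym (Λ-iso zero x′ y′) ⟩
    adj U x′ y′                                           ≡⟨ Λ-iso i x′ y′ ⟩
    adj Z (Λ i ⟨$⟩ʳ suc x′) (Λ i ⟨$⟩ʳ suc y′)             ≡⟨ ≡-sym (cong₂ (λ p q → adj Z (Λ i ⟨$⟩ʳ p) (Λ i ⟨$⟩ʳ q)) eqˣ eqʸ) ⟩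
    adj Z (X i ⟨$⟩ʳ x) (X i ⟨$⟩ʳ y)                       ∎
    where
    open ≡-Reasoning
    back : ∀ {x x′} → Λ₀ ⟨$⟩ˡ x ≡ suc x′ → x ≡ Λ₀ ⟨$⟩ʳ suc x′
    back eq = trans (≡-sym (inverseʳ Λ₀)) (cong (Λ₀ ⟨$⟩ʳ_) eq)
  inBU : ∀ i → InBU Z w zero (X i)
  inBU i = (λ x y x≢w _ y≢w _ → iso i x y x≢w y≢w) , iso i
  Xw : ∀ i → X i ⟨$⟩ʳ w ≡ suc (t i)
  Xw i = trans (cong (Λ i ⟨$⟩ʳ_) (inverseˡ Λ₀)) (Λ-zero i)
  Xv : ∀ i → X i ⟨$⟩ˡ zero ≡ Λ₀ ⟨$⟩ʳ suc (u i)
  Xv i = cong (Λ₀ ⟨$⟩ʳ_) (trans (cong (Λ i ⟨$⟩ˡ_) (≡-sym (Λ-root i))) (inverseˡ (Λ i)))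
  matching : Matching (suc r) X
  matching = record
    { inB = proj₁ ∘ inBU
    ; hasId = zero , λ _ → inverseʳ Λ₀
    -- Distinct `u i` give distinct preimages of `v`, and distinct `t i` give distinct images of
    -- `w`.
    ; distinct = λ i j i≢j →
        (λ eq → i≢j (u-inj (Fin-suc-injective (perm-injective Λ₀ (trans (≡-sym (Xv i)) (trans eq (Xv j)))))))
      , (λ eq → i≢j (t-inj (Fin-suc-injective (trans (≡-sym (Xw i)) (trans eq (Xw j))))))
    }
  supercard : SupercardVia U T Z w zero
  supercard = (flip ρ , λ x y → trans
      (cong₂ (adj Z) (restore x) (restore y)) (≡-sym (Λ-iso zero _ _)))
    , (Perm.id , λ x y → ≡-sym (T≡Z-0 x y))
    where
    -- Since `Λ₀` sends `zero` to `w`, removing this pair leaves the isomorphism from `U` onto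
    -- `Z - w`.
    ρ = remove zero Λ₀
    restore : ∀ x → punchIn w x ≡ Λ₀ ⟨$⟩ʳ suc (ρ ⟨$⟩ˡ x)
    restore x = ≡-sym (trans (punchIn-permute Λ₀ zero (ρ ⟨$⟩ˡ x)) (cong (punchIn w) (inverseʳ ρ)))

-- Counting

record Split {k} (A B : Fin k → Set) : Set where
  field
    {p q} : ℕ
    α     : Fin p → Fin k
    β     : Fin q → Fin k
    α-inj : Injective _≡_ _≡_ α
    β-inj : Injective _≡_ _≡_ β
    inA   : ∀ i → A (α i)
    inB   : ∀ j → B (β j)
    total : k ≡ p + q

∷-suc-injective : ∀ {p k} {α : Fin p → Fin k} → Injective _≡_ _≡_ α → Injective _≡_ _≡_ (zero ∷ (suc ∘ α))
∷-suc-injective inj {zero}  {zero}  _  = refl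
∷-suc-injective inj {suc i} {suc j} eq = cong suc (inj (Fin-suc-injective eq))

split : ∀ {k} {A B : Fin k → Set} → (∀ i → A i ⊎ B i) → Split A B
split {zero}  _ = record { p = 0 ; q = 0 ; α = λ () ; β = λ () ; α-inj = λ { {()} } ; β-inj = λ { {()} }
                         ; inA = λ () ; inB = λ () ; total = refl }
split {suc k} cl with cl zero | split (cl ∘ suc)
... | inj₁ a | S = record
  { α = zero ∷ (suc ∘ α) ; β = suc ∘ β
  ; α-inj = ∷-suc-injective α-inj ; β-inj = β-inj ∘ Fin-suc-injective
  ; inA = λ { zero → a ; (suc i) → inA i } ; inB = inB ; total = cong suc total }
  where open Split S
... | inj₂ b | S = record
  { α = suc ∘ α ; β = zero ∷ (suc ∘ β)
  ; α-inj = α-inj ∘ Fin-suc-injective ; β-inj = ∷-suc-injective β-inj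
  ; inA = inA ; inB = λ { zero → b ; (suc i) → inB i } ; total = trans (cong suc total) (≡-sym (+-suc _ _)) }
  where open Split S

-- The four vertices may coincide, so an index records which equation holds; the table recovers
-- `t i` from it.
four-values : ∀ {n r} {a a′ ℓ ℓ′ : Fin n} (t : Fin r → Fin n) → Injective _≡_ _≡_ t →
  (∀ i → t i ≡ a ⊎ t i ≡ a′ ⊎ t i ≡ ℓ ⊎ t i ≡ ℓ′) → r ≤ 4
four-values {n} {r} {a} {a′} {ℓ} {ℓ′} t t-inj mem = injective⇒≤ {f = λ i → code (mem i)} λ {i} {j} eq →
  t-inj (trans (≡-sym (decode (mem i))) (trans (cong table eq) (decode (mem j))))
  where
  table : Fin 4 → Fin n
  table = a ∷ a′ ∷ ℓ ∷ ℓ′ ∷ λ ()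
  code : ∀ {x} → x ≡ a ⊎ x ≡ a′ ⊎ x ≡ ℓ ⊎ x ≡ ℓ′ → Fin 4
  code (inj₁ _)               = zero
  code (inj₂ (inj₁ _))        = suc zero
  code (inj₂ (inj₂ (inj₁ _))) = suc (suc zero)
  code (inj₂ (inj₂ (inj₂ _))) = suc (suc (suc zero))
  decode : ∀ {x} (m : x ≡ a ⊎ x ≡ a′ ⊎ x ≡ ℓ ⊎ x ≡ ℓ′) → table (code m) ≡ x
  decode (inj₁ refl)               = refl
  decode (inj₂ (inj₁ refl))        = refl
  decode (inj₂ (inj₂ (inj₁ refl))) = refl
  decode (inj₂ (inj₂ (inj₂ refl))) = refl

-- Bounding the number of common cards

module _ {n c} (U T : Graph (suc n)) (conU : Connected U) (k : ℕ) (f : Fin (3 + k) → Fin (suc n))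
         (cyc : IsCycle U k f) (E : Ends T)
         (bound : ∀ (Z : Graph (suc (suc n))) w v → Sunshine Z → SupercardVia U T Z w v →
                  ∀ c′ → IsChi Z w v c′ → c′ ≤ c) where

  open Ends E

  -- Fixed `b` and `b′` mean one graph `Z` for all pairs. A single fit shows that `Z` is a sunshine
  -- graph, so the bound on χ applies to it.
  fits-bound : ∀ {r b b′} (u t : Fin r → Fin (suc n)) → Injective _≡_ _≡_ u → Injective _≡_ _≡_ t →
               (∀ i → Fit U T E b b′ (u i) (t i)) → r ≤ c
  fits-bound {zero} u t u-inj t-inj F = z≤n
  fits-bound {suc r} {b} {b′} u t u-inj t-inj F =
    family-bound U T Z (λ _ _ → refl) (λ i → Supercard.Λ (F i)) u t u-inj t-inj
      (λ i → Supercard.Λ-zero (F i)) (λ i → Supercard.Λ-root (F i)) (λ i → Supercard.Λ-iso (F i))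
      λ w v sup c′ chi → bound Z w v sunshine sup c′ chi
    where
    Z = glue T (tip a ℓ b) (tip a′ ℓ′ b′)
    sunshine : Sunshine Z
    sunshine = Supercard.connected (F zero) conU , k , _ , Supercard.cycle (F zero) f cyc

  -- For fixed `b` only one value of `b′` can occur, since two would need skeletons of different
  -- sizes.
  first-end-bound : ∀ {r b} (u t : Fin r → Fin (suc n)) → Injective _≡_ _≡_ u → Injective _≡_ _≡_ t →
                    (∀ i → ∃ λ b′ → Fit U T E b b′ (u i) (t i)) → r ≤ c
  first-end-bound {zero} u t u-inj t-inj F = z≤n
  first-end-bound {suc r} {b} u t u-inj t-inj F = fits-bound u t u-inj t-inj λ i →
    subst (λ b′ → Fit U T E b b′ (u i) (t i)) (same (F i) (F zero)) (proj₂ (F i))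
    where
    same : ∀ {u t u₁ t₁} (P : ∃ λ b′ → Fit U T E b b′ u t) (Q : ∃ λ b′ → Fit U T E b b′ u₁ t₁) → proj₁ P ≡ proj₁ Q
    same (true  , _) (true  , _) = refl
    same (false , _) (false , _) = refl
    same (true  , F) (false , G) = ⊥-elim (second-end-determined f cyc F G)
    same (false , F) (true  , G) = ⊥-elim (second-end-determined f cyc G F)

  pairs-bound : ∀ {r} (u t : Fin r → Fin (suc n)) → Injective _≡_ _≡_ u → Injective _≡_ _≡_ t →
    (∀ i → (t i ≡ a ⊎ t i ≡ a′ ⊎ t i ≡ ℓ ⊎ t i ≡ ℓ′) ⊎ (∃₂ λ b b′ → Fit U T E b b′ (u i) (t i))) →
    r ≤ 2 * c + 5
  pairs-bound {r} u t u-inj t-inj cl = begin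
    r                   ≡⟨ S.total ⟩
    S.p + S.q           ≡⟨ cong (S.p +_) R.total ⟩
    S.p + (R.p + R.q)   ≤⟨ +-mono-≤ exceptional (+-mono-≤ joined attached) ⟩
    5 + (c + c)         ≡⟨ +-comm 5 (c + c) ⟩
    c + c + 5           ≡⟨ cong (λ m → c + m + 5) (≡-sym (+-identityʳ c)) ⟩
    2 * c + 5           ∎
    where
    open ≤-Reasoning
    module S = Split (split cl)
    byFirst : ∀ {u t} → (∃₂ λ b b′ → Fit U T E b b′ u t) →
              (∃ λ b′ → Fit U T E true b′ u t) ⊎ (∃ λ b′ → Fit U T E false b′ u t)
    byFirst (true  , F) = inj₁ F
    byFirst (false , F) = inj₂ F
    module R = Split (split (byFirst ∘ S.inB))
    exceptional : S.p ≤ 5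
    -- The exceptional pairs number at most four; the step to five matches the constant in the
    -- conclusion.
    exceptional = ≤-trans (four-values (t ∘ S.α) (S.α-inj ∘ t-inj) S.inA) (n≤1+n 4)
    joined : R.p ≤ c
    joined = first-end-bound _ _ (R.α-inj ∘ S.β-inj ∘ u-inj) (R.α-inj ∘ S.β-inj ∘ t-inj) R.inA
    attached : R.q ≤ c
    attached = first-end-bound _ _ (R.β-inj ∘ S.β-inj ∘ u-inj) (R.β-inj ∘ S.β-inj ∘ t-inj) R.inB

theorem3p23 : (n : ℕ) (U T : Graph (suc n)) →
    Sunshine U → Caterpillar T → CommonCards U T 5 →
    (U⁺ : Graph (suc (suc n))) (w v : Fin (suc (suc n))) →
    Sunshine U⁺ → SupercardVia U T U⁺ w v →
    (c : ℕ) → IsChi U⁺ w v c →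
    (∀ (U′ : Graph (suc (suc n))) (w′ v′ : Fin (suc (suc n))) →
    Sunshine U′ → SupercardVia U T U′ w′ v′ →
    ∀ c′ → IsChi U′ w′ v′ c′ → c′ ≤ c) →
    ∀ k → CommonCards U T k → k ≤ 2 * c + 5
theorem3p23 n U T (conU , len , f , cyc) (conT , path@(_ , e , enum , adjs)) (_ , t₅ , _ , t₅-inj , _)
            U⁺ w v _ _ c _ bound k (u , t , u-inj , t-inj , cards) =
  pairs-bound U T conU len f cyc E bound u t u-inj t-inj λ i →
    let σ , card = extend-card U T (cards i)
    in Pair.classify U T conU conT 3≤n f cyc E acyclic σ card
  where
  3≤n : 3 ≤ suc n
  -- Five common cards come with five distinct vertices of `T`.
  3≤n = ≤-trans (m≤m+n 3 2) (injective⇒≤ t₅-inj)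
  E : Ends T
  E = ends T conT 3≤n path
  acyclic : NoCycle T
  acyclic = PathSkeleton.no-cycle T e enum adjs
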